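{- Let $x$ be an odd integer with $x>1$, let $t\ge2$ be an integer, and let $a,b,c\ge0$ be integers with $b+c\ge1$. Let $L=\{1^a,x^b,(tx)^c\}$, of size $v-1$ where $v=a+b+c+1$, and suppose $v\ge(t+2)x$. Write $v=qx+r$ with $0\le r<x$ and let $s=\lfloor q/(2t)\rfloor$. If $a\ge\omega(x,b+c)$, then $L$ has a standard linear realization whenever one of the following holds: (1) $r$ is even and $b\ge tx$; (2) $r$ and $t$ are odd and $b\ge tx+2t-3$; (3) $r$ is odd, $t$ is even, and $b\ge 4s+tx+4t-9$.
   Context: For a positive integer $n$, $K_n$ is the complete graph on vertex set $\{0,\dots,n-1\}$ and the linear length of an edge $\{u,w\}$ is $|u-w|$. A multiset of positive integers of size $n-1$ has a linear realization if some Hamiltonian path in $K_n$ has multiset of linear edge lengths equal to it; it is standard if the path starts at $0$. $\{x_1^{a_1},\dots\}$ denotes the multiset with $x_i$ of multiplicity $a_i$. For integers $z\ge2$, $d\ge0$, $\omega(z,d)$ is the smallest integer $a\ge0$ such that $\{1^a,z^d\}$ has a standard linear realization. -}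

module Defs where

open import Data.Nat using (ℕ; zero; suc; _+_; _*_; _∸_; _<_; _≤_)
open import Data.Nat.Properties using ()
open import Data.List using (List; []; _∷_; upTo; replicate; _++_; length)
open import Data.List.Relation.Binary.Permutation.Propositional using (_↭_)
open import Data.Product using (Σ; _×_; ∃)
open import Relation.Nullary using (¬_)

∣_-_∣ : ℕ → ℕ → ℕ
∣ u - w ∣ = (u ∸ w) + (w ∸ u)

edgeLengths : List ℕ → List ℕ
edgeLengths []           = []
edgeLengths (u ∷ [])     = []
edgeLengths (u ∷ w ∷ us) = ∣ u - w ∣ ∷ edgeLengths (w ∷ us)

IsHamPath : ℕ → List ℕ → Set
IsHamPath n p = p ↭ upTo n

HasStdLinReal : List ℕ → Set
HasStdLinReal L =
  Σ (List ℕ) λ p → IsHamPath (suc (length L)) (0 ∷ p) × (edgeLengths (0 ∷ p) ↭ L)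

oneZ : ℕ → ℕ → ℕ → List ℕ
oneZ a z d = replicate a 1 ++ replicate d z

IsOmega : ℕ → ℕ → ℕ → Set
IsOmega z d a = HasStdLinReal (oneZ a z d) × (∀ a′ → a′ < a → ¬ HasStdLinReal (oneZ a′ z d))

multL : ℕ → ℕ → ℕ → ℕ → ℕ → List ℕ
multL a b c x t = replicate a 1 ++ replicate b x ++ replicate c (t * x)

{-# OPTIONS --safe #-}
module Submission where

open import Defs
open import Data.Nat using (ℕ; zero; suc; _+_; _*_; _∸_; _<_; _≤_; _%_; _/_; z≤n; s≤s; _⊓_; NonZero)
open import Relation.Binary.PropositionalEquality using (_≡_; refl; sym; trans; cong; cong₂; subst; subst₂; ≢-sym)
open import Data.Product using (_×_; _,_; ∃; Σ; proj₁; proj₂)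
open import Data.Sum using (_⊎_; inj₁; inj₂)
open import Data.Empty using (⊥; ⊥-elim)
open import Data.Fin using (Fin; toℕ)
open import Data.Fin.Properties using (injective⇒≤; toℕ-injective; toℕ<n)
open import Data.List using (List; []; _∷_; _++_; map; length; lookup; replicate; upTo; applyUpTo)
open import Data.List.Properties using (++-assoc; ++-identityʳ; length-++; map-++; length-replicate)
open import Data.List.Membership.Propositional using (_∈_; _∉_)
open import Data.List.Membership.Propositional.Properties using (∈-++⁺ˡ; ∈-++⁺ʳ; ∈-++⁻)
open import Data.List.Relation.Binary.Permutation.Propositional as Perm using (_↭_; prep; swap; ↭-refl; ↭-sym; ↭-trans; ↭-reflexive; module PermutationReasoning)
open import Data.List.Relation.Binary.Permutation.Propositional.Properties using (++⁺; ++⁺ˡ; ++⁺ʳ; ++-comm; shift; shifts; ↭-length; map⁺; ∈-resp-↭; All-resp-↭; drop-∷)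
open import Data.List.Relation.Unary.All as All using (All; []; _∷_)
open import Data.List.Relation.Unary.All.Properties using (replicate⁺; ++⁻ˡ) renaming (++⁺ to All-++⁺)
open import Data.List.Relation.Unary.AllPairs using ([]; _∷_)
open import Data.List.Relation.Unary.Any using (here; there; index)
open import Data.List.Relation.Unary.Any.Properties using (lookup-index)
open import Data.List.Relation.Unary.Unique.Propositional using (Unique)
open import Data.Nat.DivMod using ([m+kn]%n≡m%n; m<n⇒m%n≡m; m%n<n; m≡m%n+[m/n]*n; m*n%n≡0)
open import Data.Nat.ListAction using (sum)
open import Data.Nat.ListAction.Properties using (sum-↭; sum-++)
open import Data.Nat.Properties
open import Data.Nat.Tactic.RingSolver using (solve-∀)
open import Relation.Nullary using (¬_; yes; no)

-- Place vertex i in row i / x of column i % x. Steps of length x and t x stay in a column, where they act as steps of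
-- length 1 and t on the rows; steps of length 1 lead to a neighbouring column. Two neighbouring columns of the same
-- height n can be traversed along one and the same path on {0,…,n-1}, upwards in the first and backwards in the
-- second, at the cost of a single step of length 1. Paths on {0,…,n-1} with t single steps and n - 1 - t steps of
-- length t exist, by the same construction with t in place of x and straight columns; together with vertical
-- prefixes this yields every c with b ≥ t x, provided that the columns can be arranged in pairs of equal height with
-- at most one left over. For d = b + c and m = d % x this succeeds with a = x - 1 if m is even, by going to the right
-- from 0 or to the left from x, and if m = 1 and b > t x. For odd m ≥ 3 and a = x one goes to the left from x and
-- visits the last three columns A, B, C in the order A, B, C, B. The remaining cases have m = 1 and b = t x.
-- Larger a follow by prepending steps of length 1. For odd m ≥ 3, ω(x, d) = x, so that a = x - 1 does not occur, and
-- conditions (2) and (3) only matter through b > t x for m = 1 and a = x - 1.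

-- The obstacle is parity. Both columns of a pair carry equally many steps of length t x, so the
-- pairs contribute an even number, and the unpaired rest, one column or the triple A, B, C, has to
-- supply the parity. With d = (B + t) x + m, the condition b ≥ t x says c ≤ B x + m. For odd m ≥ 3
-- this bound is exactly B + 1 for each of the m tall columns, which have t + B + 2 rows, and B for
-- each short one. For even t a column can carry one step more than its share, and this slack hides
-- the defects of the triple. For odd t only the shares themselves are available, so that triples
-- with sums at 3 (B + 1), or close to it on either side, are needed. As the middle column is a path
-- on the rows cut in two, these sums depend on where such a path ends and on the residue of B + 1
-- modulo t. For ω, counting residue classes modulo x gives only a ≥ x - 1; excluding a = x - 1 for
-- odd m ≥ 3 requires following the whole walk.

private variable
  k₁ k₂ k₃ u u′ w e e′ a a′ b b′ c c′ n n′ t x y z s s′ s″ d lo : ℕ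
  β β′ β₁ β₂ β₃ γ K K′ f T : ℕ
  L L′ S S′ S₁ S₂ R V : List ℕ

≤-by : ∀ {m n} k → m + k ≡ n → m ≤ n
≤-by {m} k refl = m≤m+n m k

-- Routes with three step lengths

Adj : ℕ → ℕ → ℕ → Set
Adj k u w = (u ≡ k + w) ⊎ (w ≡ k + u)

Adj-sym : Adj d u w → Adj d w u
Adj-sym (inj₁ p) = inj₂ p
Adj-sym (inj₂ p) = inj₁ p

-- The step lengths are parameters because routes occur on two levels: with lengths `1`, `x`,
-- `t * x` on the vertices, and with lengths `1` and `t` on the rows of a column.
data Route (k₁ k₂ k₃ : ℕ) : (u e : ℕ) → List ℕ → (a b c : ℕ) → Set where
  stop  : Route k₁ k₂ k₃ u u (u ∷ []) 0 0 0
  step₁ : Adj k₁ u w → Route k₁ k₂ k₃ w e L a b c → Route k₁ k₂ k₃ u e (u ∷ L) (suc a) b c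
  step₂ : Adj k₂ u w → Route k₁ k₂ k₃ w e L a b c → Route k₁ k₂ k₃ u e (u ∷ L) a (suc b) c
  step₃ : Adj k₃ u w → Route k₁ k₂ k₃ w e L a b c → Route k₁ k₂ k₃ u e (u ∷ L) a b (suc c)

route-length : Route k₁ k₂ k₃ u e L a b c → length L ≡ suc (a + b + c)
route-length stop = refl
route-length (step₁ _ r) = cong suc (route-length r)
route-length (step₂ {a = a} {b = b} {c = c} _ r) = cong suc (trans (route-length r) (cong (_+ c) (sym (+-suc a b))))
route-length (step₃ {a = a} {b = b} {c = c} _ r) = cong suc (trans (route-length r) (sym (+-suc (a + b) c)))

route-map : ∀ (f : ℕ → ℕ) {l₁ l₂ l₃} →
  (∀ {u w} → Adj k₁ u w → Adj l₁ (f u) (f w)) →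
  (∀ {u w} → Adj k₂ u w → Adj l₂ (f u) (f w)) →
  (∀ {u w} → Adj k₃ u w → Adj l₃ (f u) (f w)) →
  Route k₁ k₂ k₃ u e L a b c → Route l₁ l₂ l₃ (f u) (f e) (map f L) a b c
route-map f g₁ g₂ g₃ stop = stop
route-map f g₁ g₂ g₃ (step₁ p r) = step₁ (g₁ p) (route-map f g₁ g₂ g₃ r)
route-map f g₁ g₂ g₃ (step₂ p r) = step₂ (g₂ p) (route-map f g₁ g₂ g₃ r)
route-map f g₁ g₂ g₃ (step₃ p r) = step₃ (g₃ p) (route-map f g₁ g₂ g₃ r)

join₁ : Route k₁ k₂ k₃ u w L a b c → Adj k₁ w u′ → Route k₁ k₂ k₃ u′ e L′ a′ b′ c′ →
  Route k₁ k₂ k₃ u e (L ++ L′) (suc (a + a′)) (b + b′) (c + c′)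
join₁ stop p q = step₁ p q
join₁ (step₁ p r) p′ q = step₁ p (join₁ r p′ q)
join₁ (step₂ p r) p′ q = step₂ p (join₁ r p′ q)
join₁ (step₃ p r) p′ q = step₃ p (join₁ r p′ q)

join₂ : Route k₁ k₂ k₃ u w L a b c → Adj k₂ w u′ → Route k₁ k₂ k₃ u′ e L′ a′ b′ c′ →
  Route k₁ k₂ k₃ u e (L ++ L′) (a + a′) (suc (b + b′)) (c + c′)
join₂ stop p q = step₂ p q
join₂ (step₁ p r) p′ q = step₁ p (join₂ r p′ q)
join₂ (step₂ p r) p′ q = step₂ p (join₂ r p′ q)
join₂ (step₃ p r) p′ q = step₃ p (join₂ r p′ q)

join₃ : Route k₁ k₂ k₃ u w L a b c → Adj k₃ w u′ → Route k₁ k₂ k₃ u′ e L′ a′ b′ c′ →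
  Route k₁ k₂ k₃ u e (L ++ L′) (a + a′) (b + b′) (suc (c + c′))
join₃ stop p q = step₃ p q
join₃ (step₁ p r) p′ q = step₁ p (join₃ r p′ q)
join₃ (step₂ p r) p′ q = step₂ p (join₃ r p′ q)
join₃ (step₃ p r) p′ q = step₃ p (join₃ r p′ q)

-- The steps of length k₂ are not counted: their number follows from the length of S.
record Blk (k₁ k₂ k₃ u e : ℕ) (S : List ℕ) (a c : ℕ) : Set where
  constructor blk
  field
    {vertices} : List ℕ
    {mids}     : ℕ
    route : Route k₁ k₂ k₃ u e vertices a mids c
    perm  : vertices ↭ S

blk-to : a ≡ a′ → c ≡ c′ → S ↭ S′ → Blk k₁ k₂ k₃ u e S a c → Blk k₁ k₂ k₃ u e S′ a′ c′
blk-to refl refl p (blk r q) = blk r (↭-trans q p)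

blk-at : u ≡ u′ → e ≡ e′ → Blk k₁ k₂ k₃ u e S a c → Blk k₁ k₂ k₃ u′ e′ S a c
blk-at refl refl r = r

infixr 5 _⟨_⟩₁_ _⟨_⟩₂_ _⟨_⟩₃_

_⟨_⟩₁_ : Blk k₁ k₂ k₃ u w S a c → Adj k₁ w u′ → Blk k₁ k₂ k₃ u′ e S′ a′ c′ →
  Blk k₁ k₂ k₃ u e (S ++ S′) (suc (a + a′)) (c + c′)
blk r p ⟨ q ⟩₁ blk r′ p′ = blk (join₁ r q r′) (++⁺ p p′)

_⟨_⟩₂_ : Blk k₁ k₂ k₃ u w S a c → Adj k₂ w u′ → Blk k₁ k₂ k₃ u′ e S′ a′ c′ →
  Blk k₁ k₂ k₃ u e (S ++ S′) (a + a′) (c + c′)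
blk r p ⟨ q ⟩₂ blk r′ p′ = blk (join₂ r q r′) (++⁺ p p′)

_⟨_⟩₃_ : Blk k₁ k₂ k₃ u w S a c → Adj k₃ w u′ → Blk k₁ k₂ k₃ u′ e S′ a′ c′ →
  Blk k₁ k₂ k₃ u e (S ++ S′) (a + a′) (suc (c + c′))
blk r p ⟨ q ⟩₃ blk r′ p′ = blk (join₃ r q r′) (++⁺ p p′)

single : Blk k₁ k₂ k₃ u u (u ∷ []) 0 0
single = blk stop ↭-refl

reverse-route : Route k₁ k₂ k₃ u e L a b c → Blk k₁ k₂ k₃ e u L a c
reverse-route stop = single
reverse-route (step₁ {u = u} {L = L} {a = a} {c = c} p r) =
  blk-to (cong suc (+-identityʳ a)) (+-identityʳ c) (++-comm L (u ∷ [])) (reverse-route r ⟨ Adj-sym p ⟩₁ single)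
reverse-route (step₂ {u = u} {L = L} {a = a} {c = c} p r) =
  blk-to (+-identityʳ a) (+-identityʳ c) (++-comm L (u ∷ [])) (reverse-route r ⟨ Adj-sym p ⟩₂ single)
reverse-route (step₃ {u = u} {L = L} {a = a} {c = c} p r) =
  blk-to (+-identityʳ a) (cong suc (+-identityʳ c)) (++-comm L (u ∷ [])) (reverse-route r ⟨ Adj-sym p ⟩₃ single)

rev : Blk k₁ k₂ k₃ u e S a c → Blk k₁ k₂ k₃ e u S a c
rev (blk r p) = blk-to refl refl p (reverse-route r)

-- Patterns, columns and grids

ap : ℕ → ℕ → ℕ → List ℕ
ap d s zero    = []
ap d s (suc n) = s ∷ ap d (d + s) n

length-ap : ∀ d s n → length (ap d s n) ≡ n
length-ap d s zero    = refl
length-ap d s (suc n) = cong suc (length-ap d (d + s) n)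

ap-++ : ∀ d s m n → ap d s (m + n) ≡ ap d s m ++ ap d (m * d + s) n
ap-++ d s zero n = refl
ap-++ d s (suc m) n = cong (s ∷_) (trans (ap-++ d (d + s) m n) (cong (λ i → ap d (d + s) m ++ ap d i n) (lemma d s m)))
  where
  lemma : ∀ d s m → m * d + (d + s) ≡ suc m * d + s
  lemma = solve-∀

map-ap : ∀ x s j n → map (λ i → s + i * x) (ap 1 j n) ≡ ap x (s + j * x) n
map-ap x s j zero = refl
map-ap x s j (suc n) = cong (s + j * x ∷_) (trans (map-ap x s (suc j) n) (cong (λ i → ap x i n) (lemma x s j)))
  where
  lemma : ∀ x s j → s + (x + j * x) ≡ x + (s + j * x)
  lemma = solve-∀

upTo≡ap : ∀ n → upTo n ≡ ap 1 0 n
upTo≡ap = go 0 (λ i → i) (λ i → sym (+-identityʳ i))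
  where
  go : ∀ j (f : ℕ → ℕ) → (∀ i → f i ≡ i + j) → ∀ n → applyUpTo f n ≡ ap 1 j n
  go j f h zero = refl
  go j f h (suc n) = cong₂ _∷_ (h 0) (go (suc j) (λ i → f (suc i)) (λ i → trans (h (suc i)) (sym (+-suc i j))) n)

-- A pattern is a path on {0,…,n-1} from 0 to e with β steps of length t, its other steps having length 1
-- (the step length k₁ = 0 is not used).
Pat : (t n e β : ℕ) → Set
Pat t n e β = Blk 0 1 t 0 e (ap 1 0 n) 0 β

-- Row `i` of column `s` is the vertex `s + i * x`. A pattern has no steps of the first kind, which
-- leaves that slot free for the horizontal steps of length 1.
place : ∀ x s → Blk 0 1 t u e S 0 β → Blk 1 x (t * x) (s + u * x) (s + e * x) (map (λ i → s + i * x) S) 0 β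
place {t = t} x s (blk r p) = blk (go r) (map⁺ (λ i → s + i * x) p)
  where
  cell : ℕ → ℕ
  cell i = s + i * x
  up : ∀ k {u w} → u ≡ k + w → cell u ≡ k * x + cell w
  up k {w = w} refl = lemma s k w x
    where
    lemma : ∀ s k w x → s + (k + w) * x ≡ k * x + (s + w * x)
    lemma = solve-∀
  adj : ∀ k {u w} → Adj k u w → Adj (k * x) (cell u) (cell w)
  adj k (inj₁ q) = inj₁ (up k q)
  adj k (inj₂ q) = inj₂ (up k q)
  adj₁ : ∀ {u w} → Adj 1 u w → Adj x (cell u) (cell w)
  adj₁ {u} {w} q = subst (λ i → Adj i (cell u) (cell w)) (*-identityˡ x) (adj 1 q)
  go : ∀ {u e L b c} → Route 0 1 t u e L 0 b c → Route 1 x (t * x) (cell u) (cell e) (map cell L) 0 b c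
  go stop = stop
  go (step₂ q r) = step₂ (adj₁ q) (go r)
  go (step₃ q r) = step₃ (adj t q) (go r)

place-column : ∀ x s → Blk 0 1 t u e (ap 1 0 n) 0 β → Blk 1 x (t * x) (s + u * x) (s + e * x) (ap x s n) 0 β
place-column {n = n} x s P = blk-to refl refl (↭-reflexive (trans (map-ap x s 0 n) (cong (λ i → ap x i n) (+-identityʳ s)))) (place x s P)

Adj-suc : Adj d u w → Adj d (suc u) (suc w)
Adj-suc {d} {w = w} (inj₁ refl) = inj₁ (sym (+-suc d w))
Adj-suc {d} {u = u} (inj₂ refl) = inj₂ (sym (+-suc d u))

shift-block : Blk k₁ k₂ k₃ u e S a c → Blk k₁ k₂ k₃ (suc u) (suc e) (map suc S) a c
shift-block (blk r p) = blk (route-map suc Adj-suc Adj-suc Adj-suc r) (map⁺ suc p)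

map-suc-ap : ∀ d s n → map suc (ap d s n) ≡ ap d (suc s) n
map-suc-ap d s zero = refl
map-suc-ap d s (suc n) = cong (suc s ∷_) (trans (map-suc-ap d (d + s) n) (cong (λ i → ap d i n) (sym (+-suc d s))))

prefix : Pat t n e β → Pat t (suc n) (suc e) β
prefix {n = n} P = single ⟨ inj₂ refl ⟩₂ blk-to refl refl (↭-reflexive (map-suc-ap 1 0 n)) (shift-block P)

prefixes : ∀ j → Pat t n e β → Pat t (j + n) (j + e) β
prefixes zero P = P
prefixes (suc j) P = prefix (prefixes j P)

straight : ∀ t n → Pat t (suc n) n 0
straight t zero = single
straight t (suc n) = prefix (straight t n)

-- This makes the construction reusable one level down: a route with steps 1 and `z` is read as a
-- pattern with `z` in the role of `t`. The number of its long steps, which `Blk` does not record,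
-- is recovered from the number of vertices.
pattern-of : ∀ {z} α β → Blk 1 z y u e S α 0 → length S ≡ suc (α + β) → Blk 0 1 z u e S 0 β
pattern-of {y = y} {u = u} {e = e} {z = z} α β (blk {L} {b} r p) len =
  blk (subst (Route 0 1 z u e L 0 α) b≡β (go r)) p
  where
  b≡β : b ≡ β
  b≡β = +-cancelˡ-≡ α b β (suc-injective (trans (cong suc (sym (+-identityʳ (α + b)))) (trans (sym (route-length r)) (trans (↭-length p) len))))
  go : ∀ {u e L a b} → Route 1 z y u e L a b 0 → Route 0 1 z u e L 0 a b
  go stop = stop
  go (step₁ q r) = step₂ q (go r)
  go (step₂ q r) = step₃ q (go r)

band : (x s k n : ℕ) → List ℕ
band x s zero    n = []
band x s (suc k) n = ap x s n ++ band x (suc s) k n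

band-0 : ∀ x s k → band x s k 0 ≡ []
band-0 x s zero = refl
band-0 x s (suc k) = band-0 x (suc s) k

band-row : ∀ x s k n → band x s k (suc n) ↭ ap 1 s k ++ band x (x + s) k n
band-row x s zero n = ↭-refl
band-row x s (suc k) n = prep s (begin
  ap x (x + s) n ++ band x (suc s) k (suc n)                     ↭⟨ ++⁺ˡ (ap x (x + s) n) (band-row x (suc s) k n) ⟩
  ap x (x + s) n ++ (ap 1 (suc s) k ++ band x (x + suc s) k n)   ↭⟨ shifts (ap x (x + s) n) (ap 1 (suc s) k) ⟩
  ap 1 (suc s) k ++ (ap x (x + s) n ++ band x (x + suc s) k n)   ≡⟨ cong (λ i → ap 1 (suc s) k ++ (ap x (x + s) n ++ band x i k n)) (+-suc x s) ⟩
  ap 1 (suc s) k ++ (ap x (x + s) n ++ band x (suc (x + s)) k n) ∎)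
  where open PermutationReasoning

band-++ : ∀ x s k l n → band x s (k + l) n ≡ band x s k n ++ band x (k + s) l n
band-++ x s zero l n = refl
band-++ x s (suc k) l n = trans (cong (ap x s n ++_) (trans (band-++ x (suc s) k l n) (cong (λ i → band x (suc s) k n ++ band x i l n) (+-suc k s))))
  (sym (++-assoc (ap x s n) (band x (suc s) k n) _))

-- By induction on the rows: `band-row` takes the lowest row off all columns, and what remains is
-- the same arrangement moved up by `r + w`.
grid : ∀ r w s q → band (r + w) s r (suc q) ++ band (r + w) (r + s) w q ↭ ap 1 s (q * (r + w) + r)
grid r w s zero = ↭-reflexive (trans (cong₂ _++_ (one r s) (band-0 (r + w) (r + s) w)) (++-identityʳ _))
  where
  one : ∀ k s → band (r + w) s k 1 ≡ ap 1 s k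
  one zero s = refl
  one (suc k) s = cong (s ∷_) (one k (suc s))
grid r w s (suc q) = begin
  band X s r (2 + q) ++ band X (r + s) w (suc q)
    ↭⟨ ++⁺ (band-row X s r (suc q)) (band-row X (r + s) w q) ⟩
  (ap 1 s r ++ B₁) ++ (ap 1 (r + s) w ++ B₂)
    ≡⟨ ++-assoc (ap 1 s r) B₁ _ ⟩
  ap 1 s r ++ (B₁ ++ (ap 1 (r + s) w ++ B₂))
    ↭⟨ ++⁺ˡ (ap 1 s r) (shifts B₁ (ap 1 (r + s) w)) ⟩
  ap 1 s r ++ (ap 1 (r + s) w ++ (B₁ ++ B₂))
    ≡⟨ sym (++-assoc (ap 1 s r) (ap 1 (r + s) w) (B₁ ++ B₂)) ⟩
  (ap 1 s r ++ ap 1 (r + s) w) ++ (B₁ ++ B₂)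
    ≡⟨ cong₂ _++_ (sym (trans (ap-++ 1 s r w) (cong (λ i → ap 1 s r ++ ap 1 (i + s) w) (*-identityʳ r))))
         (cong (λ i → B₁ ++ band X i w q) (lemma₁ r w s)) ⟩
  ap 1 s X ++ (band X (X + s) r (suc q) ++ band X (r + (X + s)) w q)
    ↭⟨ ++⁺ˡ (ap 1 s X) (grid r w (X + s) q) ⟩
  ap 1 s X ++ ap 1 (X + s) (q * X + r)
    ≡⟨ sym (trans (cong (ap 1 s) (+-assoc X (q * X) r)) (trans (ap-++ 1 s X (q * X + r)) (cong (λ i → ap 1 s X ++ ap 1 (i + s) (q * X + r)) (*-identityʳ X)))) ⟩
  ap 1 s (suc q * X + r) ∎
  where
  open PermutationReasoning
  X : ℕ
  X = r + w
  B₁ B₂ : List ℕ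
  B₁ = band X (X + s) r (suc q)
  B₂ = band X (X + (r + s)) w q
  lemma₁ : ∀ r w s → r + w + (r + s) ≡ r + (r + w + s)
  lemma₁ = solve-∀

-- Pairs of equal columns and frames

Adj-+ : ∀ k → Adj d u w → Adj d (u + k) (w + k)
Adj-+ {d} {w = w} k (inj₁ refl) = inj₁ (+-assoc d w k)
Adj-+ {d} {u = u} k (inj₂ refl) = inj₂ (+-assoc d u k)

column : ∀ x s → Pat t n e β → Blk 1 x (t * x) s (s + e * x) (ap x s n) 0 β
column x s P = blk-at (+-identityʳ s) refl (place-column x s P)

pair : Adj 1 s s′ → Pat t n e β → Blk 1 x (t * x) s s′ (ap x s n ++ ap x s′ n) 1 (β + β)
pair {s} {s′} {e = e} {x = x} p P = column x s P ⟨ Adj-+ (e * x) p ⟩₁ rev (column x s′ P)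

extend : Adj 1 s″ s′ → Adj 1 s′ s → Pat t n e′ β → Blk 1 x (t * x) s e S a c →
  Blk 1 x (t * x) s″ e ((ap x s″ n ++ ap x s′ n) ++ S) (2 + a) (β + β + c)
extend p q P Q = pair p P ⟨ q ⟩₁ Q

-- Every number up to `K` is demanded, not just `K`, so that a total can be split arbitrarily over
-- several columns.
Cap : ℕ → ℕ → ℕ → Set
Cap t n K = ∀ β → β ≤ K → ∃ λ e → Pat t n e β

split-≤ : ∀ m {n γ} → γ ≤ m + n → ∃ λ γ₁ → ∃ λ γ₂ → γ₁ ≤ m × γ₂ ≤ n × γ ≡ γ₁ + γ₂
split-≤ m {n} {γ} h = γ ⊓ m , γ ∸ m , m⊓n≤n γ m , subst (γ ∸ m ≤_) (m+n∸m≡n m n) (∸-monoˡ-≤ m h) , trans (sym (m⊓n+n∸m≡n m γ)) (cong (_+ (γ ∸ m)) (⊓-comm m γ))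

private
  double : ∀ β γ c → β + β + (γ * 2 + c) ≡ (β + γ) * 2 + c
  double = solve-∀
  double′ : ∀ β γ c → γ * 2 + (β + β + c) ≡ (β + γ) * 2 + c
  double′ = solve-∀
  two : ∀ p s → p * 2 + (2 + s) ≡ 2 + p * 2 + s
  two = solve-∀

-- Each pair chooses its own `β ≤ K` and contributes `β + β`. Hence only an even amount `γ * 2` is
-- spread over the pairs, and an odd remainder has to be carried by `Q`.
pairsˡ : Cap t n K → ∀ p → γ ≤ p * K → Blk 1 x (t * x) s e S a c →
  Blk 1 x (t * x) (p * 2 + s) e (band x (suc s) (p * 2) n ++ S) (p * 2 + a) (γ * 2 + c)
pairsˡ cap zero z≤n Q = Q
pairsˡ {n = n} {K = K} {x = x} {s = s} {S = S} {a = a} {c = c} cap (suc p) h Q with split-≤ K h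
... | β , γ , β≤K , γ≤ , refl =
  blk-at (two p s) refl (blk-to (two p a) (double′ β γ c) perm (pairsˡ cap p γ≤ (extend (inj₁ refl) (inj₁ refl) (proj₂ (cap β β≤K)) Q)))
  where
  A₁ A₂ B : List ℕ
  A₁ = ap x (1 + s) n
  A₂ = ap x (2 + s) n
  B = band x (3 + s) (p * 2) n
  open PermutationReasoning
  perm : B ++ ((A₂ ++ A₁) ++ S) ↭ (A₁ ++ (A₂ ++ B)) ++ S
  perm = begin
    B ++ ((A₂ ++ A₁) ++ S)   ↭⟨ ++⁺ˡ B (++⁺ʳ S (++-comm A₂ A₁)) ⟩
    B ++ ((A₁ ++ A₂) ++ S)   ↭⟨ shifts B (A₁ ++ A₂) ⟩
    (A₁ ++ A₂) ++ (B ++ S)   ≡⟨ sym (++-assoc (A₁ ++ A₂) B S) ⟩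
    ((A₁ ++ A₂) ++ B) ++ S   ≡⟨ cong (_++ S) (++-assoc A₁ A₂ B) ⟩
    (A₁ ++ (A₂ ++ B)) ++ S   ∎

pairsʳ : Cap t n K → ∀ p → γ ≤ p * K → Blk 1 x (t * x) (p * 2 + s) e S a c →
  Blk 1 x (t * x) s e (band x s (p * 2) n ++ S) (p * 2 + a) (γ * 2 + c)
pairsʳ cap zero z≤n Q = Q
pairsʳ {n = n} {K = K} {x = x} {s = s} {S = S} {a = a} {c = c} cap (suc p) h Q with split-≤ K h
... | β , γ , β≤K , γ≤ , refl =
  blk-to refl (double β γ c) (↭-reflexive perm) (extend (inj₂ refl) (inj₂ refl) (proj₂ (cap β β≤K)) (pairsʳ cap p γ≤ (blk-at (sym (two p s)) refl Q)))
  where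
  A₀ A₁ B : List ℕ
  A₀ = ap x s n
  A₁ = ap x (1 + s) n
  B = band x (2 + s) (p * 2) n
  perm : (A₀ ++ A₁) ++ (B ++ S) ≡ (A₀ ++ (A₁ ++ B)) ++ S
  perm = trans (++-assoc A₀ A₁ (B ++ S)) (trans (cong (A₀ ++_) (sym (++-assoc A₁ B S))) (sym (++-assoc A₀ (A₁ ++ B) S)))

-- R collects the vertices still to be appended at the end of the path.
record Part (x y e v : ℕ) (R : List ℕ) (a c : ℕ) : Set where
  constructor part
  field
    {covered} : List ℕ
    path      : Blk 1 x y 0 e covered a c
    rest      : covered ++ R ↭ ap 1 0 v

full : Part x y e n [] a c → Blk 1 x y 0 e (ap 1 0 n) a c
full (part {S} P r) = blk-to refl refl (↭-trans (↭-reflexive (sym (++-identityʳ S))) r) P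

part-to : n ≡ n′ → a ≡ a′ → c ≡ c′ → Part x y e n R a c → Part x y e n′ R a′ c′
part-to refl refl refl P = P

-- Vertex 0 is left at once by a step of length `x`, and the columns are those of the interval
-- starting at 1. So the class of 0 becomes column `x` and loses its lowest row, and the unpaired
-- columns `1, …, r` at the left end are tall.
frame-tall : ∀ q r p p′ → x ≡ r + p * 2 + p′ * 2 → Cap t (suc q) K → Cap t q K′ → γ ≤ p * K + p′ * K′ →
  Blk 1 x (t * x) r e S a c → S ++ R ↭ band x 1 r (suc q) →
  Part x (t * x) e (suc (q * x + (r + p * 2))) R (p′ * 2 + (p * 2 + a)) (γ * 2 + c)
frame-tall {K = K} {S = S} {a = a} {c = c} {R = R} q r p p′ refl cap cap′ h Q hR with split-≤ (p * K) h
... | γ₁ , γ₂ , h₁ , h₂ , refl =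
  part (blk-to refl (lemma γ₁ γ₂ c) ↭-refl (single ⟨ inj₂ (entry r (p * 2) (p′ * 2)) ⟩₂ pairsˡ cap′ p′ h₂ (pairsˡ cap p h₁ Q)))
    (prep 0 perm)
  where
  lemma : ∀ γ₁ γ₂ c → γ₂ * 2 + (γ₁ * 2 + c) ≡ (γ₁ + γ₂) * 2 + c
  lemma = solve-∀
  entry : ∀ r p p′ → p′ + (p + r) ≡ r + p + p′ + 0
  entry = solve-∀
  X : ℕ
  X = r + p * 2 + p′ * 2
  D U : List ℕ
  D = band X (suc (p * 2 + r)) (p′ * 2) q
  U = band X (suc r) (p * 2) (suc q)
  open PermutationReasoning
  perm : (D ++ (U ++ S)) ++ R ↭ ap 1 1 (q * X + (r + p * 2))
  perm = begin
    (D ++ (U ++ S)) ++ R                      ≡⟨ ++-assoc D (U ++ S) R ⟩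
    D ++ ((U ++ S) ++ R)                      ≡⟨ cong (D ++_) (++-assoc U S R) ⟩
    D ++ (U ++ (S ++ R))                      ↭⟨ ++⁺ˡ D (++⁺ˡ U hR) ⟩
    D ++ (U ++ band X 1 r (suc q))            ↭⟨ ++⁺ˡ D (++-comm U (band X 1 r (suc q))) ⟩
    D ++ (band X 1 r (suc q) ++ U)            ≡⟨ cong (λ i → D ++ (band X 1 r (suc q) ++ band X i (p * 2) (suc q))) (+-comm 1 r) ⟩
    D ++ (band X 1 r (suc q) ++ band X (r + 1) (p * 2) (suc q)) ≡⟨ cong (D ++_) (sym (band-++ X 1 r (p * 2) (suc q))) ⟩
    D ++ band X 1 (r + p * 2) (suc q)         ↭⟨ ++-comm D _ ⟩
    band X 1 (r + p * 2) (suc q) ++ D         ≡⟨ cong (λ i → band X 1 (r + p * 2) (suc q) ++ band X i (p′ * 2) q) (trans (cong suc (+-comm (p * 2) r)) (+-comm 1 (r + p * 2))) ⟩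
    band X 1 (r + p * 2) (suc q) ++ band X (r + p * 2 + 1) (p′ * 2) q ↭⟨ grid (r + p * 2) (p′ * 2) 1 q ⟩
    ap 1 1 (q * X + (r + p * 2)) ∎

frame-short : ∀ q r p → x ≡ r + p * 2 → Cap t q K → γ ≤ p * K →
  Blk 1 x (t * x) r e S a c → S ++ R ↭ band x 1 r q →
  Part x (t * x) e (suc (q * x)) R (p * 2 + a) (γ * 2 + c)
frame-short {S = S} {R = R} q r p refl cap h Q hR =
  part (single ⟨ inj₂ (entry r (p * 2)) ⟩₂ pairsˡ cap p h Q) (prep 0 perm)
  where
  entry : ∀ r p → p + r ≡ r + p + 0
  entry = solve-∀
  X : ℕ
  X = r + p * 2
  U : List ℕ
  U = band X (suc r) (p * 2) q
  open PermutationReasoning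
  perm : (U ++ S) ++ R ↭ ap 1 1 (q * X)
  perm = begin
    (U ++ S) ++ R            ≡⟨ ++-assoc U S R ⟩
    U ++ (S ++ R)            ↭⟨ ++⁺ˡ U hR ⟩
    U ++ band X 1 r q        ↭⟨ ++-comm U _ ⟩
    band X 1 r q ++ U        ≡⟨ cong (λ i → band X 1 r q ++ band X i (p * 2) q) (+-comm 1 r) ⟩
    band X 1 r q ++ band X (r + 1) (p * 2) q ≡⟨ sym (band-++ X 1 r (p * 2) q) ⟩
    band X 1 X q             ↭⟨ grid 0 X 1 q ⟩
    ap 1 1 (q * X + 0)       ≡⟨ cong (ap 1 1) (+-identityʳ (q * X)) ⟩
    ap 1 1 (q * X)           ∎

-- The class of 0 is traversed from its lowest vertex, without a step spent on leaving it. The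
-- unpaired columns are now the rightmost ones, hence short.
frame-right : ∀ q r p p′ → x ≡ p * 2 + (p′ * 2 + r) → Cap t (suc q) K → Cap t q K′ → γ ≤ p * K + p′ * K′ →
  Blk 1 x (t * x) (p′ * 2 + (p * 2 + 0)) e S a c → S ++ R ↭ band x (p′ * 2 + (p * 2 + 0)) r q →
  Part x (t * x) e (q * x + p * 2) R (p * 2 + (p′ * 2 + a)) (γ * 2 + c)
frame-right {K = K} {S = S} {a = a} {c = c} {R = R} q r p p′ refl cap cap′ h Q hR with split-≤ (p * K) h
... | γ₁ , γ₂ , h₁ , h₂ , refl =
  part (blk-to refl (lemma γ₁ γ₂ c) ↭-refl (pairsʳ cap p h₁ (pairsʳ cap′ p′ h₂ Q))) perm
  where
  lemma : ∀ γ₁ γ₂ c → γ₁ * 2 + (γ₂ * 2 + c) ≡ (γ₁ + γ₂) * 2 + c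
  lemma = solve-∀
  X : ℕ
  X = p * 2 + (p′ * 2 + r)
  D U : List ℕ
  D = band X (p * 2 + 0) (p′ * 2) q
  U = band X 0 (p * 2) (suc q)
  open PermutationReasoning
  perm : (U ++ (D ++ S)) ++ R ↭ ap 1 0 (q * X + p * 2)
  perm = begin
    (U ++ (D ++ S)) ++ R    ≡⟨ ++-assoc U (D ++ S) R ⟩
    U ++ ((D ++ S) ++ R)    ≡⟨ cong (U ++_) (++-assoc D S R) ⟩
    U ++ (D ++ (S ++ R))    ↭⟨ ++⁺ˡ U (++⁺ˡ D hR) ⟩
    U ++ (D ++ band X (p′ * 2 + (p * 2 + 0)) r q) ≡⟨ cong (U ++_) (sym (band-++ X (p * 2 + 0) (p′ * 2) r q)) ⟩
    U ++ band X (p * 2 + 0) (p′ * 2 + r) q ↭⟨ grid (p * 2) (p′ * 2 + r) 0 q ⟩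
    ap 1 0 (q * X + p * 2)  ∎

-- Three columns in four visits

∈-ap : ∀ s n → w ∈ ap 1 s n → s ≤ w × w < s + n
∈-ap s (suc n) (here refl) = ≤-refl , m<m+n s (s≤s z≤n)
∈-ap s (suc n) (there h) with ∈-ap (suc s) n h
... | p , r = <⇒≤ p , ≤-trans r (≤-reflexive (sym (+-suc s n)))

end-∈ : Route k₁ k₂ k₃ u e L a b c → e ∈ L
end-∈ stop = here refl
end-∈ (step₁ _ r) = there (end-∈ r)
end-∈ (step₂ _ r) = there (end-∈ r)
end-∈ (step₃ _ r) = there (end-∈ r)

-- As 0 is the start, the end lies in a higher row, so that a straight middle column can be cut just
-- below it: `suc f` rows lie below the cut and `suc m` rows above.
pattern-end : Pat t (2 + n) e β → ∃ λ f → ∃ λ m → e ≡ suc f × suc m + suc f ≡ 2 + n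
pattern-end {n = n} (blk stop p) with ↭-length p
... | ()
pattern-end {n = n} (blk (step₂ {w = w} {e = e} {L = L} _ r) p) = body (∈-ap 1 (suc n) (∈-resp-↭ (drop-∷ p) (end-∈ r)))
  where
  body : ∀ {e} → 1 ≤ e × e < 1 + suc n → ∃ λ f → ∃ λ m → e ≡ suc f × suc m + suc f ≡ 2 + n
  body {suc f} (_ , s≤s h) = f , n ∸ f , refl , cong suc (trans (+-suc (n ∸ f) f) (cong suc (m∸n+n≡m (≤-pred h))))
pattern-end {n = n} (blk (step₃ {w = w} {e = e} {L = L} _ r) p) = body (∈-ap 1 (suc n) (∈-resp-↭ (drop-∷ p) (end-∈ r)))
  where
  body : ∀ {e} → 1 ≤ e × e < 1 + suc n → ∃ λ f → ∃ λ m → e ≡ suc f × suc m + suc f ≡ 2 + n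
  body {suc f} (_ , s≤s h) = f , n ∸ f , refl , cong suc (trans (+-suc (n ∸ f) f) (cong suc (m∸n+n≡m (≤-pred h))))

-- Data for a path through three consecutive columns a, b, c of n rows with only three horizontal steps:
-- up column a along A to row top, in b back along P₂ to row turn, down c along the reverse of C, and in b along P₁.
record Triple (t n T : ℕ) : Set where
  constructor triple
  field
    {top turn foot ν ν₁ ν₂ ν₃} : ℕ
    {U₁ U₂} : List ℕ
    A     : Pat t n top ν
    P₁    : Blk 0 1 t 0 foot U₁ 0 ν₁
    P₂    : Blk 0 1 t turn top U₂ 0 ν₂
    C     : Pat t n turn ν₃
    cover : U₁ ++ U₂ ↭ ap 1 0 n
    total : T ≡ ν + ν₁ + ν₂ + ν₃

triple-block : ∀ x s → Triple t n T → ∃ λ e → Σ (List ℕ) λ S →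
  Blk 1 x (t * x) (2 + s) e S 3 T × S ++ [] ↭ band x s 3 n
triple-block {n = n} x s (triple {e} {e′} {f} {β} {β₁} {β₂} {β₃} {S₁} {S₂} A P₁ P₂ C cover refl) =
  _ , _ ,
  blk-to refl (lemma β β₁ β₂ β₃) ↭-refl
    (column x (2 + s) A
      ⟨ Adj-+ {d = 1} (e * x) (inj₁ refl) ⟩₁ rev (place x (1 + s) P₂)
      ⟨ Adj-+ {d = 1} (e′ * x) (inj₁ refl) ⟩₁ rev (column x s C)
      ⟨ inj₂ refl ⟩₁ blk-at (+-identityʳ (suc s)) refl (place x (1 + s) P₁)) ,
  perm
  where
  lemma : ∀ β β₁ β₂ β₃ → β + (β₂ + (β₃ + β₁)) ≡ β + β₁ + β₂ + β₃
  lemma = solve-∀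
  h : ℕ → ℕ
  h i = suc s + i * x
  X₀ X₁ X₂ M₁ M₂ : List ℕ
  X₀ = ap x s n
  X₁ = ap x (1 + s) n
  X₂ = ap x (2 + s) n
  M₁ = map h S₁
  M₂ = map h S₂
  M-cover : M₁ ++ M₂ ↭ X₁
  M-cover = ↭-trans (↭-reflexive (sym (map-++ h S₁ S₂))) (↭-trans (map⁺ h cover)
    (↭-reflexive (trans (map-ap x (suc s) 0 n) (cong (λ i → ap x i n) (+-identityʳ (suc s))))))
  open PermutationReasoning
  perm : (X₂ ++ (M₂ ++ (X₀ ++ M₁))) ++ [] ↭ X₀ ++ (X₁ ++ (X₂ ++ []))
  perm = begin
    (X₂ ++ (M₂ ++ (X₀ ++ M₁))) ++ []  ≡⟨ ++-identityʳ _ ⟩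
    X₂ ++ (M₂ ++ (X₀ ++ M₁))          ↭⟨ ++⁺ˡ X₂ (++-comm M₂ (X₀ ++ M₁)) ⟩
    X₂ ++ ((X₀ ++ M₁) ++ M₂)          ≡⟨ cong (X₂ ++_) (++-assoc X₀ M₁ M₂) ⟩
    X₂ ++ (X₀ ++ (M₁ ++ M₂))          ↭⟨ ++⁺ˡ X₂ (++⁺ˡ X₀ M-cover) ⟩
    X₂ ++ (X₀ ++ X₁)                  ↭⟨ ++-comm X₂ (X₀ ++ X₁) ⟩
    (X₀ ++ X₁) ++ X₂                  ≡⟨ ++-assoc X₀ X₁ X₂ ⟩
    X₀ ++ (X₁ ++ X₂)                  ≡⟨ cong (λ i → X₀ ++ (X₁ ++ i)) (sym (++-identityʳ X₂)) ⟩
    X₀ ++ (X₁ ++ (X₂ ++ []))          ∎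

triple-to : T ≡ K → Triple t n T → Triple t n K
triple-to refl τ = τ

-- The new lowest row is prefixed to `A`, to `C` and to the piece `P₁` starting at row 0; the piece
-- `P₂` is only moved up. All new steps are single, so the sum stays.
lift : Triple t n T → Triple t (suc n) T
lift {n = n} (triple {U₁ = S₁} {S₂} A P₁ P₂ C cover total) =
  triple (prefix A) (single ⟨ inj₂ refl ⟩₂ shift-block P₁) (shift-block P₂) (prefix C)
    (prep 0 (↭-trans (↭-reflexive (sym (map-++ suc S₁ S₂))) (↭-trans (map⁺ suc cover) (↭-reflexive (map-suc-ap 1 0 n))))) total

lifts : ∀ j → Triple t n T → Triple t (j + n) T
lifts zero τ = τ
lifts (suc j) τ = lift (lifts j τ)

-- `A` is the join of both pieces of the middle column, so their long steps count twice; `C` has to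
-- end where the second piece begins.
split₁ : Blk 0 1 t 0 f S₁ 0 β₁ → Adj 1 f e′ → Blk 0 1 t e′ e S₂ 0 β₂ → Pat t n e′ β₃ → S₁ ++ S₂ ↭ ap 1 0 n →
  Triple t n ((β₁ + β₂) * 2 + β₃)
split₁ {β₁ = β₁} {β₂ = β₂} {β₃ = β₃} P₁ p P₂ C cover =
  triple (blk-to refl refl cover (P₁ ⟨ p ⟩₂ P₂)) P₁ P₂ C cover (lemma β₁ β₂ β₃)
  where
  lemma : ∀ β₁ β₂ β₃ → (β₁ + β₂) * 2 + β₃ ≡ β₁ + β₂ + β₁ + β₂ + β₃
  lemma = solve-∀

-- When `A` is cut at a long step, this step occurs in `A` but not in the middle column. The extra 1
-- changes the parity of the sum.
splitₜ : Blk 0 1 t 0 f S₁ 0 β₁ → Adj t f e′ → Blk 0 1 t e′ e S₂ 0 β₂ → Pat t n e′ β₃ → S₁ ++ S₂ ↭ ap 1 0 n →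
  Triple t n (suc ((β₁ + β₂) * 2 + β₃))
splitₜ {β₁ = β₁} {β₂ = β₂} {β₃ = β₃} P₁ p P₂ C cover =
  triple (blk-to refl refl cover (P₁ ⟨ p ⟩₃ P₂)) P₁ P₂ C cover (lemma β₁ β₂ β₃)
  where
  lemma : ∀ β₁ β₂ β₃ → suc ((β₁ + β₂) * 2 + β₃) ≡ suc (β₁ + β₂) + β₁ + β₂ + β₃
  lemma = solve-∀

segment : ∀ t s n → Blk 0 1 t s (n + s) (ap 1 s (suc n)) 0 0
segment t s zero = single
segment t s (suc n) = single ⟨ inj₂ refl ⟩₂ blk-at refl (+-suc n s) (segment t (suc s) n)

-- All long steps are put into `C`. The other two columns are straight, and a straight column can be
-- cut at any row, in particular at the end of `P`.
triple-straight : Pat t (2 + n) e β → Triple t (2 + n) β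
triple-straight {t} {n} P with pattern-end P
... | f , m , refl , h = split₁ (straight t f) (inj₂ refl) (segment t (suc f) m) P
  (↭-reflexive (trans (sym (trans (ap-++ 1 0 (suc f) (suc m)) (cong (λ i → ap 1 0 (suc f) ++ ap 1 i (suc m)) (lemma f))))
    (cong (ap 1 0) (trans (+-comm (suc f) (suc m)) h))))
  where
  lemma : ∀ f → suc f * 1 + 0 ≡ suc f
  lemma = solve-∀

-- `A` and `C` are the same path with `β + 1` long steps, the last of which leads to its end. The
-- middle column is this path cut at that last step, so only one long step is lost: the sum is 3 (β
-- + 1) - 1.
drop-last : Part z y f n (e ∷ []) a 0 → Adj z f e → n ≡ 2 + (a + β) → Triple z n (3 * β + 2)
drop-last {z} {y} {f} {n} {e} {a} {β} (part {S} P r) p refl =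
  triple-to (lemma β) (splitₜ P₁ p single A r)
  where
  lemma : ∀ β → suc ((β + 0) * 2 + suc (β + 0)) ≡ 3 * β + 2
  lemma = solve-∀
  len : length S ≡ suc (a + β)
  len = suc-injective (trans (+-comm 1 (length S)) (trans (sym (length-++ S)) (trans (↭-length r) (length-ap 1 0 n))))
  P₁ : Blk 0 1 z 0 f S 0 β
  P₁ = pattern-of a β P len
  A : Pat z n e (suc (β + 0))
  A = blk-to refl refl r (P₁ ⟨ p ⟩₃ single)

whole : Part z y e n [] a 0 → n ≡ suc (a + β) → Pat z n e β
whole {n = n} {a = a} {β = β} P h = pattern-of a β (full P) (trans (length-ap 1 0 n) h)

-- Paths with two step lengths

straights : ∀ t n → Cap t (suc n) 0
straights t n zero z≤n = n , straight t n

-- With `t = 1` the third step length is `x` as well and is never taken, so the same frames produce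
-- paths with two step lengths.
bar : ∀ x s k → Blk 1 x (1 * x) s (s + k * x) (ap x s (suc k)) 0 0
bar x s k = column x s (straight 1 k)

ap-snoc : ∀ d s n → ap d s n ++ (n * d + s ∷ []) ≡ ap d s (suc n)
ap-snoc d s n = trans (sym (ap-++ d s n 1)) (cong (ap d s) (+-comm n 1))

-- Paths on z + β vertices with z - 1 steps of length 1, all residue classes modulo z being traversed straight.
odd-even : ∀ k p p′ {z} → z ≡ p * 2 + (p′ * 2 + 1) →
  Pat z (z + (k * z + p * 2)) (p′ * 2 + (p * 2 + 0) + k * z) (k * z + p * 2)
odd-even k p p′ refl = whole
  (part-to (+-assoc Z (k * Z) (p * 2)) refl refl
    (frame-right (suc k) 1 p p′ refl (straights 1 (suc k)) (straights 1 k) z≤n (bar _ (p′ * 2 + (p * 2 + 0)) k) ↭-refl))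
  (lemma (k * Z) p p′)
  where
  Z : ℕ
  Z = p * 2 + (p′ * 2 + 1)
  lemma : ∀ i p p′ → p * 2 + (p′ * 2 + 1) + (i + p * 2) ≡ suc (p * 2 + (p′ * 2 + 0) + (i + p * 2))
  lemma = solve-∀

-- The last column is traversed only up to the row below its top; the top vertex is the one appended
-- by a long step, as `drop-last` wants it.
odd-0-drop : ∀ k p {z} → z ≡ p * 2 + 1 → Triple z (z + suc k * z) (3 * (p * 2 + k * z) + 2)
odd-0-drop k p refl = drop-last
  (part-to (+-identityʳ _) refl refl
    (frame-right (suc (suc k)) 1 0 p refl (straights 1 (suc (suc k))) (straights 1 (suc k)) z≤n (bar _ (p * 2 + 0) k)
      (↭-reflexive (trans (ap-snoc Z (p * 2 + 0) (suc k)) (sym (++-identityʳ _))))))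
  (inj₂ (lemma₂ (k * Z) p))
  (lemma (k * Z) p)
  where
  Z : ℕ
  Z = p * 2 + 1
  lemma : ∀ i p → p * 2 + 1 + (p * 2 + 1 + i) ≡ 2 + (p * 2 + 0 + (p * 2 + i))
  lemma = solve-∀
  lemma₂ : ∀ i p → p * 2 + 1 + i + (p * 2 + 0) ≡ p * 2 + 1 + (p * 2 + 0 + i)
  lemma₂ = solve-∀

module _ (k p p′ : ℕ) where
  private
    Z : ℕ
    Z = 1 + p * 2 + p′ * 2
    size : ∀ i p p′ → suc (1 + p * 2 + p′ * 2 + i + (1 + p * 2)) ≡ 1 + p * 2 + p′ * 2 + (i + (2 + p * 2))
    size = solve-∀

  odd-tall : Pat Z (Z + (k * Z + (2 + p * 2))) (1 + suc k * Z) (k * Z + (2 + p * 2))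
  odd-tall = whole
    (part-to (size (k * Z) p p′) refl refl
      (frame-tall (suc k) 1 p p′ refl (straights 1 (suc k)) (straights 1 k) z≤n (bar Z 1 (suc k)) ↭-refl))
    (lemma (k * Z) p p′)
    where
    lemma : ∀ i p p′ → 1 + p * 2 + p′ * 2 + (i + (2 + p * 2)) ≡ suc (p′ * 2 + (p * 2 + 0) + (i + (2 + p * 2)))
    lemma = solve-∀

  odd-tall-drop : Triple Z (Z + (k * Z + (2 + p * 2))) (3 * (k * Z + (1 + p * 2)) + 2)
  odd-tall-drop = drop-last
    (part-to (size (k * Z) p p′) refl refl
      (frame-tall (suc k) 1 p p′ refl (straights 1 (suc k)) (straights 1 k) z≤n (bar Z 1 k)
        (↭-reflexive (trans (ap-snoc Z 1 (suc k)) (sym (++-identityʳ _))))))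
    (inj₂ (lemma₂ (k * Z) p p′))
    (lemma (k * Z) p p′)
    where
    lemma : ∀ i p p′ → 1 + p * 2 + p′ * 2 + (i + (2 + p * 2)) ≡ 2 + (p′ * 2 + (p * 2 + 0) + (i + (1 + p * 2)))
    lemma = solve-∀
    lemma₂ : ∀ i p p′ → 1 + p * 2 + p′ * 2 + i + 1 ≡ 1 + p * 2 + p′ * 2 + (1 + i)
    lemma₂ = solve-∀

module _ (k p : ℕ) where
  private
    Z : ℕ
    Z = 1 + p * 2
    size : ∀ i p → suc (1 + p * 2 + i) ≡ 1 + p * 2 + (i + 1)
    size = solve-∀

  odd-1 : Pat Z (Z + (k * Z + 1)) (1 + k * Z) (k * Z + 1)
  odd-1 = whole
    (part-to (size (k * Z) p) refl refl (frame-short (suc k) 1 p refl (straights 1 k) (z≤n {p * 0}) (bar Z 1 k) ↭-refl))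
    (lemma (k * Z) p)
    where
    lemma : ∀ i p → 1 + p * 2 + (i + 1) ≡ suc (p * 2 + 0 + (i + 1))
    lemma = solve-∀

  odd-1-drop : Triple Z (Z + (suc k * Z + 1)) (3 * (suc k * Z) + 2)
  odd-1-drop = drop-last
    (part-to (size (suc k * Z) p) refl refl
      (frame-short (suc (suc k)) 1 p refl (straights 1 (suc k)) (z≤n {p * 0}) (bar Z 1 k)
        (↭-reflexive (trans (ap-snoc Z 1 (suc k)) (sym (++-identityʳ _))))))
    (inj₂ (lemma₂ (k * Z) p))
    (lemma (suc k * Z) p)
    where
    lemma : ∀ i p → 1 + p * 2 + (i + 1) ≡ 2 + (p * 2 + 0 + i)
    lemma = solve-∀
    lemma₂ : ∀ i p → 1 + p * 2 + i + 1 ≡ 1 + p * 2 + (1 + i)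
    lemma₂ = solve-∀

-- An odd number of long columns cannot be traversed straight, so that three of them are visited four times.
odd-odd : ∀ k p p′ {z} → z ≡ 3 + p * 2 + p′ * 2 → ∃ λ e → Pat z (suc (z + (k * z + (3 + p * 2)))) e (k * z + (3 + p * 2))
odd-odd k p p′ refl with triple-block {t = 1} (3 + p * 2 + p′ * 2) 1 (triple-straight (straight 1 (suc k)))
... | e , S , Q , h = e , whole
    (part-to (size (k * Z) p p′) refl refl
      (frame-tall (suc k) 3 p p′ refl (straights 1 (suc k)) (straights 1 k) z≤n Q h))
    (lemma (k * Z) p p′)
  where
  Z : ℕ
  Z = 3 + p * 2 + p′ * 2
  size : ∀ i p p′ → suc (3 + p * 2 + p′ * 2 + i + (3 + p * 2)) ≡ suc (3 + p * 2 + p′ * 2 + (i + (3 + p * 2)))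
  size = solve-∀
  lemma : ∀ i p p′ → suc (3 + p * 2 + p′ * 2 + (i + (3 + p * 2))) ≡ suc (p′ * 2 + (p * 2 + 3) + (i + (3 + p * 2)))
  lemma = solve-∀

even-even : ∀ k p p′ {z} → z ≡ p * 2 + (p′ * 2 + 2) → ∃ λ e → Pat z (z + (k * z + p * 2)) e (k * z + p * 2)
even-even k p p′ refl = _ , whole
  (part-to (+-assoc Z (k * Z) (p * 2)) refl refl
    (frame-right (suc k) 2 p p′ refl (straights 1 (suc k)) (straights 1 k) z≤n
      (pair {t = 1} {x = Z} (inj₂ refl) (straight 1 k)) (↭-reflexive (++-assoc (ap Z j (suc k)) (ap Z (suc j) (suc k)) []))))
  (lemma (k * Z) p p′)
  where
  Z j : ℕ
  Z = p * 2 + (p′ * 2 + 2)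
  j = p′ * 2 + (p * 2 + 0)
  lemma : ∀ i p p′ → p * 2 + (p′ * 2 + 2) + (i + p * 2) ≡ suc (p * 2 + (p′ * 2 + 1) + (i + p * 2))
  lemma = solve-∀

private
  -- The descent in column 1 stops in the second row, so that vertex 1 is left over and can be
  -- reached by a final long step downwards.
  hairpin-drop : ∀ x k → Blk 1 x (1 * x) 2 (1 + x) (ap x 2 (2 + k) ++ ap x (1 + x) (suc k)) 1 0
  hairpin-drop x k = bar x 2 (suc k) ⟨ inj₁ (lemma x k) ⟩₁ rev (bar x (1 + x) k)
    where
    lemma : ∀ x k → 2 + suc k * x ≡ 1 + (1 + x + k * x)
    lemma = solve-∀

  hairpin-drop-cover : ∀ x k → (ap x 2 (2 + k) ++ ap x (1 + x) (suc k)) ++ 1 ∷ [] ↭ band x 1 2 (2 + k)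
  hairpin-drop-cover x k = begin
    (A ++ B) ++ 1 ∷ []    ↭⟨ ++-comm (A ++ B) (1 ∷ []) ⟩
    1 ∷ (A ++ B)          ↭⟨ prep 1 (++-comm A B) ⟩
    1 ∷ (B ++ A)          ≡⟨ cong₂ (λ i j → 1 ∷ (ap x i (suc k) ++ j)) (+-comm 1 x) (sym (++-identityʳ A)) ⟩
    band x 1 2 (2 + k)    ∎
    where
    open PermutationReasoning
    A B : List ℕ
    A = ap x 2 (2 + k)
    B = ap x (1 + x) (suc k)

  hairpin : ∀ x k → Blk 1 x (1 * x) 2 1 (ap x 2 (suc k) ++ ap x 1 (suc k)) 1 0
  hairpin x k = pair {t = 1} (inj₁ refl) (straight 1 k)

  hairpin-cover : ∀ x k → (ap x 2 (suc k) ++ ap x 1 (suc k)) ++ [] ↭ band x 1 2 (suc k)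
  hairpin-cover x k = ↭-trans (↭-reflexive (++-identityʳ _)) (↭-trans (++-comm (ap x 2 (suc k)) (ap x 1 (suc k)))
    (↭-reflexive (cong (ap x 1 (suc k) ++_) (sym (++-identityʳ _)))))

module _ (k p p′ : ℕ) where
  private
    Z : ℕ
    Z = 2 + p * 2 + p′ * 2
    size : ∀ i p p′ → suc (2 + p * 2 + p′ * 2 + i + (2 + p * 2)) ≡ 2 + p * 2 + p′ * 2 + (i + (3 + p * 2))
    size = solve-∀

  even-tall : Pat Z (Z + (k * Z + (3 + p * 2))) 1 (k * Z + (3 + p * 2))
  even-tall = whole
    (part-to (size (k * Z) p p′) refl refl
      (frame-tall (suc k) 2 p p′ refl (straights 1 (suc k)) (straights 1 k) z≤n (hairpin Z (suc k)) (hairpin-cover Z (suc k))))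
    (lemma (k * Z) p p′)
    where
    lemma : ∀ i p p′ → 2 + p * 2 + p′ * 2 + (i + (3 + p * 2)) ≡ suc (p′ * 2 + (p * 2 + 1) + (i + (3 + p * 2)))
    lemma = solve-∀

  even-tall-drop : Triple Z (Z + (k * Z + (3 + p * 2))) (3 * (k * Z + (2 + p * 2)) + 2)
  even-tall-drop = drop-last
    (part-to (size (k * Z) p p′) refl refl
      (frame-tall (suc k) 2 p p′ refl (straights 1 (suc k)) (straights 1 k) z≤n (hairpin-drop Z k) (hairpin-drop-cover Z k)))
    (inj₁ (+-comm 1 Z))
    (lemma (k * Z) p p′)
    where
    lemma : ∀ i p p′ → 2 + p * 2 + p′ * 2 + (i + (3 + p * 2)) ≡ 2 + (p′ * 2 + (p * 2 + 1) + (i + (2 + p * 2)))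
    lemma = solve-∀

module _ (k p : ℕ) where
  private
    Z : ℕ
    Z = 2 + p * 2
    size : ∀ i p → suc (2 + p * 2 + i) ≡ 2 + p * 2 + (i + 1)
    size = solve-∀

  even-1 : Pat Z (Z + (k * Z + 1)) 1 (k * Z + 1)
  even-1 = whole
    (part-to (size (k * Z) p) refl refl (frame-short (suc k) 2 p refl (straights 1 k) (z≤n {p * 0}) (hairpin Z k) (hairpin-cover Z k)))
    (lemma (k * Z) p)
    where
    lemma : ∀ i p → 2 + p * 2 + (i + 1) ≡ suc (p * 2 + 1 + (i + 1))
    lemma = solve-∀

  even-1-drop : Triple Z (Z + (suc k * Z + 1)) (3 * (suc k * Z) + 2)
  even-1-drop = drop-last
    (part-to (size (suc k * Z) p) refl refl
      (frame-short (suc (suc k)) 2 p refl (straights 1 (suc k)) (z≤n {p * 0}) (hairpin-drop Z k) (hairpin-drop-cover Z k)))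
    (inj₁ (+-comm 1 Z))
    (lemma (suc k * Z) p)
    where
    lemma : ∀ i p → 2 + p * 2 + (i + 1) ≡ 2 + (p * 2 + 1 + i)
    lemma = solve-∀

-- The path 0, 1, … is cut after 0 and combined with a path ending at 1.
triple-at-1 : Pat z (suc n) 1 β → Pat z n e β′ → Triple z (suc n) (β′ * 2 + β)
triple-at-1 {n = n} P Q = split₁ single (inj₂ refl) (blk-to refl refl (↭-reflexive (map-suc-ap 1 0 n)) (shift-block Q)) P ↭-refl

-- The path of odd-even is cut after its first column and combined with odd-tall, which ends at the top of the second one.
odd-tall-split : ∀ k p p′ {z} → z ≡ 2 + p * 2 + (p′ * 2 + 1) → Triple z (z + (k * z + (2 + p * 2))) (3 * (k * z + (2 + p * 2)))
odd-tall-split k p p′ {z} hz = triple-to total (split₁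
    (pattern-of 0 (suc k) (bar z 0 (suc k)) (length-ap z 0 (2 + k)))
    (inj₂ refl)
    (pattern-of α ν (blk-to (lemma p p′) refl ↭-refl P₂) len)
    (subst (λ i → Pat i (i + (k * i + (2 + p * 2))) (1 + suc k * i) (k * i + (2 + p * 2))) (trans (lemma₁ p p′) (sym hz)) (odd-tall k p (suc p′)))
    cover)
  where
  α j ν : ℕ
  α = 1 + p * 2 + p′ * 2
  j = p′ * 2 + (p * 2 + 2)
  ν = k * suc α + (1 + p * 2)
  lemma : ∀ p p′ → suc (p * 2 + (p′ * 2 + 0)) ≡ 1 + p * 2 + p′ * 2
  lemma = solve-∀
  lemma₁ : ∀ p p′ → 1 + p * 2 + suc p′ * 2 ≡ 2 + p * 2 + (p′ * 2 + 1)
  lemma₁ = solve-∀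
  lemma₃ : ∀ p p′ → 2 + p * 2 + (p′ * 2 + 1) ≡ suc (suc (1 + p * 2 + p′ * 2))
  lemma₃ = solve-∀
  z≡ : z ≡ suc (suc α)
  z≡ = trans hz (lemma₃ p p′)
  lemma₄ : ∀ k α p → suc k + (k * suc α + (1 + p * 2)) ≡ k * suc (suc α) + (2 + p * 2)
  lemma₄ = solve-∀
  ν≡ : suc k + ν ≡ k * z + (2 + p * 2)
  ν≡ = trans (lemma₄ k α p) (cong (λ i → k * i + (2 + p * 2)) (sym z≡))
  thrice : ∀ i → i * 2 + i ≡ 3 * i
  thrice = solve-∀
  total : (suc k + ν) * 2 + (k * z + (2 + p * 2)) ≡ 3 * (k * z + (2 + p * 2))
  total = trans (cong (λ i → i * 2 + (k * z + (2 + p * 2))) ν≡) (thrice (k * z + (2 + p * 2)))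
  D₀ D₁ B B′ D₂ : List ℕ
  D₀ = ap z 0 (2 + k)
  D₁ = ap z 1 (2 + k)
  B = band z 2 (p * 2) (2 + k)
  B′ = band z (p * 2 + 2) (p′ * 2) (suc k)
  D₂ = D₁ ++ (B ++ (B′ ++ ap z j (suc k)))
  P₂ : Blk 1 z (1 * z) (1 + suc k * z) (j + k * z) D₂ (suc (p * 2 + (p′ * 2 + 0))) 0
  P₂ = rev (bar z 1 (suc k)) ⟨ inj₂ refl ⟩₁
    pairsʳ {t = 1} {γ = 0} (straights 1 (suc k)) p z≤n (pairsʳ {t = 1} {γ = 0} (straights 1 k) p′ z≤n (bar z j k))
  open PermutationReasoning
  cover : D₀ ++ D₂ ↭ ap 1 0 (z + (k * z + (2 + p * 2)))
  cover = begin
    D₀ ++ (D₁ ++ (B ++ (B′ ++ ap z j (suc k))))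
      ≡⟨ cong (D₀ ++_) (sym (++-assoc D₁ B _)) ⟩
    D₀ ++ ((D₁ ++ B) ++ (B′ ++ ap z j (suc k)))
      ≡⟨ sym (++-assoc D₀ (D₁ ++ B) _) ⟩
    band z 0 (2 + p * 2) (2 + k) ++ (B′ ++ ap z j (suc k))
      ≡⟨ cong (λ i → band z 0 (2 + p * 2) (2 + k) ++ (B′ ++ i)) (sym (++-identityʳ _)) ⟩
    band z 0 (2 + p * 2) (2 + k) ++ (B′ ++ band z j 1 (suc k))
      ≡⟨ cong (band z 0 (2 + p * 2) (2 + k) ++_) (sym (band-++ z (p * 2 + 2) (p′ * 2) 1 (suc k))) ⟩
    band z 0 (2 + p * 2) (2 + k) ++ band z (p * 2 + 2) (p′ * 2 + 1) (suc k)
      ≡⟨ cong (λ i → band z 0 (2 + p * 2) (2 + k) ++ band z i (p′ * 2 + 1) (suc k)) (trans (+-comm (p * 2) 2) (sym (+-identityʳ _))) ⟩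
    band z 0 (2 + p * 2) (2 + k) ++ band z (2 + p * 2 + 0) (p′ * 2 + 1) (suc k)
      ↭⟨ subst (λ i → band i 0 (2 + p * 2) (2 + k) ++ band i (2 + p * 2 + 0) (p′ * 2 + 1) (suc k) ↭ ap 1 0 (suc k * i + (2 + p * 2))) (sym hz)
           (grid (2 + p * 2) (p′ * 2 + 1) 0 (suc k)) ⟩
    ap 1 0 (z + k * z + (2 + p * 2))
      ≡⟨ cong (ap 1 0) (+-assoc z (k * z) _) ⟩
    ap 1 0 (z + (k * z + (2 + p * 2))) ∎
  len : length D₂ ≡ suc (α + ν)
  len = +-cancelˡ-≡ (2 + k) _ _ (trans (trans (cong (_+ length D₂) (sym (length-ap z 0 (2 + k)))) (sym (length-++ D₀)))
    (trans (↭-length cover) (trans (length-ap 1 0 _) (trans (cong₂ _+_ z≡ (sym ν≡)) (lemma₅ k α ν)))))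
    where
    lemma₅ : ∀ k α ν → suc (suc α) + (suc k + ν) ≡ 2 + k + suc (α + ν)
    lemma₅ = solve-∀

pat-to : ∀ {t n n′ e e′ β β′} → n ≡ n′ → e ≡ e′ → β ≡ β′ → Pat t n e β → Pat t n′ e′ β′
pat-to refl refl refl P = P

-- Residues of the number of long steps, and existence of patterns

half : ∀ n → (∃ λ p → n ≡ p * 2) ⊎ (∃ λ p → n ≡ 1 + p * 2)
half zero = inj₁ (0 , refl)
half (suc n) with half n
... | inj₁ (p , refl) = inj₂ (p , refl)
... | inj₂ (p , refl) = inj₁ (suc p , refl)

*2≢1+*2 : ∀ i j → i * 2 ≡ 1 + j * 2 → ⊥
*2≢1+*2 (suc i) (suc j) h = *2≢1+*2 i j (suc-injective (suc-injective h))

-- The residue of `β` modulo `t` is the number of long classes modulo `t` among `t + β` rows.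
-- Residues 0 and 1 stand apart: there all columns have equal height when the path goes to the
-- right, respectively to the left. The parameters `p` and `p′` count the pairs in the frames.
data OddForm (t β : ℕ) : Set where
  res-0    : ∀ k p → t ≡ p * 2 + 1 → β ≡ k * t → OddForm t β
  res-1    : ∀ k p → t ≡ 1 + p * 2 → β ≡ k * t + 1 → OddForm t β
  res-even : ∀ k p p′ → t ≡ 2 + p * 2 + (p′ * 2 + 1) → β ≡ k * t + (2 + p * 2) → OddForm t β
  res-odd  : ∀ k p p′ → t ≡ 2 + suc p * 2 + (p′ * 2 + 1) → β ≡ k * t + (3 + p * 2) → OddForm t β

odd-form : ∀ h β → OddForm (3 + h * 2) β
odd-form h zero = res-0 0 (suc h) (+-comm 1 (suc h * 2)) refl
odd-form h (suc β) with odd-form h β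
... | res-0 k p ht refl = res-1 k p (trans ht (+-comm (p * 2) 1)) (+-comm 1 (k * (3 + h * 2)))
... | res-1 k p ht refl = res-even k 0 h (lemma h) (sym (+-suc (k * (3 + h * 2)) 1))
  where
  lemma : ∀ h → 3 + h * 2 ≡ 2 + (h * 2 + 1)
  lemma = solve-∀
... | res-even k p zero ht refl = res-0 (suc k) (suc h) (+-comm 1 (suc h * 2)) (trans (lemma (k * (3 + h * 2)) p) (cong (_+ k * (3 + h * 2)) (sym ht)))
  where
  lemma : ∀ i p → suc (i + (2 + p * 2)) ≡ 2 + p * 2 + 1 + i
  lemma = solve-∀
... | res-even k p (suc p′) ht refl = res-odd k p p′ (trans ht (lemma p p′)) (sym (+-suc (k * (3 + h * 2)) (2 + p * 2)))
  where
  lemma : ∀ p p′ → 2 + p * 2 + (suc p′ * 2 + 1) ≡ 2 + suc p * 2 + (p′ * 2 + 1)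
  lemma = solve-∀
... | res-odd k p p′ ht refl = res-even k (suc p) p′ ht (sym (+-suc (k * (3 + h * 2)) (3 + p * 2)))

data EvenForm (t β : ℕ) : Set where
  res-even : ∀ k p p′ → t ≡ p * 2 + (p′ * 2 + 2) → β ≡ k * t + p * 2 → EvenForm t β
  res-1    : ∀ k p → t ≡ 2 + p * 2 → β ≡ k * t + 1 → EvenForm t β
  res-odd  : ∀ k p p′ → t ≡ 2 + p * 2 + suc p′ * 2 → β ≡ k * t + (3 + p * 2) → EvenForm t β

even-form : ∀ h β → EvenForm (2 + h * 2) β
even-form h zero = res-even 0 0 h (+-comm 2 (h * 2)) refl
even-form h (suc β) with even-form h β
... | res-even k zero p′ ht refl = res-1 k h refl (lemma (k * (2 + h * 2)))
  where
  lemma : ∀ i → suc (i + 0) ≡ i + 1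
  lemma = solve-∀
... | res-even k (suc p) p′ ht refl = res-odd k p p′ (trans ht (lemma p p′)) (sym (+-suc (k * (2 + h * 2)) (2 + p * 2)))
  where
  lemma : ∀ p p′ → suc p * 2 + (p′ * 2 + 2) ≡ 2 + p * 2 + suc p′ * 2
  lemma = solve-∀
... | res-1 k zero ht refl = res-even (suc k) 0 0 ht (trans (lemma (k * (2 + h * 2))) (cong (λ i → i + k * (2 + h * 2) + 0) (sym ht)))
  where
  lemma : ∀ i → suc (i + 1) ≡ 2 + i + 0
  lemma = solve-∀
... | res-1 k (suc p) ht refl = res-even k 1 p (trans ht (lemma p)) (sym (+-suc (k * (2 + h * 2)) 1))
  where
  lemma : ∀ p → 2 + suc p * 2 ≡ 2 + (p * 2 + 2)
  lemma = solve-∀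
... | res-odd k p zero ht refl = res-even (suc k) 0 (suc p) (trans ht (lemma₁ p)) (trans (lemma (k * (2 + h * 2)) p) (cong (λ i → i + k * (2 + h * 2) + 0) (sym ht)))
  where
  lemma : ∀ i p → suc (i + (3 + p * 2)) ≡ 2 + p * 2 + 2 + i + 0
  lemma = solve-∀
  lemma₁ : ∀ p → 2 + p * 2 + 2 ≡ suc p * 2 + 2
  lemma₁ = solve-∀
... | res-odd k p (suc p′) ht refl = res-even k (2 + p) p′ (trans ht (lemma₁ p p′)) (lemma (k * (2 + h * 2)) p)
  where
  lemma : ∀ i p → suc (i + (3 + p * 2)) ≡ i + (2 + p) * 2
  lemma = solve-∀
  lemma₁ : ∀ p p′ → 2 + p * 2 + suc (suc p′) * 2 ≡ (2 + p) * 2 + (p′ * 2 + 2)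
  lemma₁ = solve-∀

even-good : ∀ h β → let t = 2 + h * 2 in ∃ λ e → Pat t (t + β) e β
even-good h β with even-form h β
... | res-even k p p′ ht refl = even-even k p p′ ht
... | res-1 k p ht refl = subst (λ t → ∃ λ e → Pat t (t + (k * t + 1)) e (k * t + 1)) (sym ht) (_ , even-1 k p)
... | res-odd k p p′ ht refl = subst (λ t → ∃ λ e → Pat t (t + (k * t + (3 + p * 2))) e (k * t + (3 + p * 2))) (sym ht) (_ , even-tall k p (suc p′))

-- For even `t` an odd `β` has an odd residue, and then the path closes with a hairpin over columns
-- 2 and 1.
even-ends-at-1 : ∀ h i → let t = 2 + h * 2 ; β = 1 + i * 2 in Pat t (t + β) 1 β
even-ends-at-1 h i = go refl (even-form h (1 + i * 2))
  where
  go : ∀ {β} → β ≡ 1 + i * 2 → EvenForm (2 + h * 2) β → Pat (2 + h * 2) (2 + h * 2 + β) 1 β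
  go hβ (res-even k p p′ ht refl) = ⊥-elim (*2≢1+*2 (k * suc h + p) i (trans (lemma k h p) hβ))
    where
    lemma : ∀ k h p → (k * suc h + p) * 2 ≡ k * (2 + h * 2) + p * 2
    lemma = solve-∀
  go hβ (res-1 k p ht refl) = subst (λ t → Pat t (t + (k * t + 1)) 1 (k * t + 1)) (sym ht) (even-1 k p)
  go hβ (res-odd k p p′ ht refl) = subst (λ t → Pat t (t + (k * t + (3 + p * 2))) 1 (k * t + (3 + p * 2))) (sym ht) (even-tall k p (suc p′))

OddModulus : ℕ → Set
OddModulus t = ∃ λ h → t ≡ 3 + h * 2

EvenModulus : ℕ → Set
EvenModulus t = ∃ λ h → t ≡ 2 + h * 2

modulus : ∀ {t} → 2 ≤ t → OddModulus t ⊎ EvenModulus t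
modulus {t} 2≤t with half t
modulus ()          | inj₁ (zero , refl)
... | inj₁ (suc h , refl) = inj₂ (h , refl)
modulus (s≤s ())    | inj₂ (zero , refl)
... | inj₂ (suc h , refl) = inj₁ (h , refl)

Good : ℕ → ℕ → Set
Good t β = ∃ λ e → Pat t (t + β) e β

-- An odd number, at least 3, of long classes for odd `t`. Going to the right, the odd number of
-- tall columns puts the border between tall and short ones inside a pair; going to the left, the
-- odd number of short columns does the same.
BadForm : ℕ → ℕ → Set
BadForm t β = ∃ λ k → ∃ λ p → ∃ λ p′ → t ≡ 2 + suc p * 2 + (p′ * 2 + 1) × β ≡ k * t + (3 + p * 2)

odd-good : ∀ {t β} → OddForm t β → Good t β ⊎ BadForm t β
odd-good {t} (res-0 k p ht refl) = inj₁ (_ , pat-to (cong (t +_) (+-identityʳ (k * t))) refl (+-identityʳ (k * t)) (odd-even k 0 p ht))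
odd-good (res-1 k p refl refl) = inj₁ (_ , odd-1 k p)
odd-good (res-even k p p′ ht refl) = inj₁ (_ , subst (λ t → Pat t (t + (k * t + (2 + p * 2))) (1 + suc k * t) (k * t + (2 + p * 2))) (sym (trans ht (lemma p p′))) (odd-tall k p (suc p′)))
  where
  lemma : ∀ p p′ → 2 + p * 2 + (p′ * 2 + 1) ≡ 1 + p * 2 + suc p′ * 2
  lemma = solve-∀
odd-good (res-odd k p p′ ht hβ) = inj₂ (k , p , p′ , ht , hβ)

good-or-bad : ∀ {t} → 2 ≤ t → ∀ β → Good t β ⊎ BadForm t β
good-or-bad 2≤t β with modulus 2≤t
... | inj₁ (h , refl) = odd-good (odd-form h β)
... | inj₂ (h , refl) = inj₁ (even-good h β)

-- One row beyond `t + β` pays for the bad residues: it admits one more single step, which is the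
-- additional horizontal step of the three-column path. In the good case the row is filled by a
-- prefix.
pattern-exists : ∀ {t} → 2 ≤ t → ∀ β → ∃ λ e → Pat t (suc (t + β)) e β
pattern-exists 2≤t β with good-or-bad 2≤t β
... | inj₁ (e , P) = suc e , prefix P
... | inj₂ (k , p , p′ , ht , refl) = odd-odd k p (suc p′) (trans ht (lemma p p′))
  where
  lemma : ∀ p p′ → 2 + suc p * 2 + (p′ * 2 + 1) ≡ 3 + p * 2 + suc p′ * 2
  lemma = solve-∀

∃-≤ : ∀ {m n} → m ≤ n → ∃ λ j → j + m ≡ n
∃-≤ {m} {n} h = n ∸ m , m∸n+n≡m h

capacity : ∀ {t} → 2 ≤ t → ∀ K → Cap t (suc (t + K)) K
capacity {t} 2≤t K β β≤K with ∃-≤ β≤K | pattern-exists 2≤t β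
... | j , refl | e , P = j + e , subst (λ i → Pat t i (j + e) β) (lemma j t β) (prefixes j P)
  where
  lemma : ∀ j t β → j + suc (t + β) ≡ suc (t + (j + β))
  lemma = solve-∀

-- For even `t` there are no bad residues, which saves a row compared with `capacity`; `even-plan`
-- lives on this slack.
even-capacity : ∀ {t} → EvenModulus t → ∀ K → Cap t (t + K) K
even-capacity {t} (h , refl) K β β≤K with ∃-≤ β≤K | even-good h β
... | j , refl | e , P = j + e , subst (λ i → Pat t i (j + e) β) (lemma j t β) (prefixes j P)
  where
  lemma : ∀ j t β → j + (t + β) ≡ t + (j + β)
  lemma = solve-∀

-- The two columns that use this differ in height by one and need not follow the same path; only the
-- sum of their long steps and the neighbouring ends matter. A bad `b` is replaced by `b - 1` and
-- `b + 1`, whose residues are even and whose paths can be made to end at `suc k * t` and one row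
-- above.
bump : ∀ {t} → 2 ≤ t → ∀ b → 1 ≤ b → ∃ λ e → ∃ λ β → ∃ λ β′ → Pat t (t + b) e β × Pat t (suc (t + b)) (suc e) β′ × β + β′ ≡ b * 2
bump {t} 2≤t b _ with good-or-bad 2≤t b
... | inj₁ (e , P) = e , b , b , P , prefix P , lemma b
  where
  lemma : ∀ b → b + b ≡ b * 2
  lemma = solve-∀
... | inj₂ (k , p , p′ , ht , refl) =
  suc k * t , k * t + (2 + p * 2) , k * t + (4 + p * 2) ,
  pat-to (n₁ t (k * t) p) e₁ refl (prefix (odd-even k (suc p) (suc p′) (trans ht (lemma₂ p p′)))) ,
  pat-to (n₂ t (k * t) p) refl refl
    (subst (λ t → Pat t (t + (k * t + (2 + suc p * 2))) (1 + suc k * t) (k * t + (2 + suc p * 2))) (sym (trans ht (lemma₃ p p′))) (odd-tall k (suc p) (suc p′))) ,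
  lemma (k * t) p
  where
  lemma : ∀ i p → i + (2 + p * 2) + (i + (4 + p * 2)) ≡ (i + (3 + p * 2)) * 2
  lemma = solve-∀
  lemma₂ : ∀ p p′ → 2 + suc p * 2 + (p′ * 2 + 1) ≡ suc p * 2 + (suc p′ * 2 + 1)
  lemma₂ = solve-∀
  lemma₃ : ∀ p p′ → 2 + suc p * 2 + (p′ * 2 + 1) ≡ 1 + suc p * 2 + suc p′ * 2
  lemma₃ = solve-∀
  lemma₄ : ∀ p p′ → suc (suc p′ * 2 + (suc p * 2 + 0)) ≡ 2 + suc p * 2 + (p′ * 2 + 1)
  lemma₄ = solve-∀
  e₁ : suc (suc p′ * 2 + (suc p * 2 + 0) + k * t) ≡ suc k * t
  e₁ = cong (_+ k * t) (trans (lemma₄ p p′) (sym ht))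
  n₁ : ∀ t i p → suc (t + (i + suc p * 2)) ≡ t + (i + (3 + p * 2))
  n₁ = solve-∀
  n₂ : ∀ t i p → t + (i + (2 + suc p * 2)) ≡ suc (t + (i + (3 + p * 2)))
  n₂ = solve-∀

-- Triples with large sums, and the distribution of the long steps

triple-cast : ∀ {t n n′ T T′} → n ≡ n′ → T ≡ T′ → Triple t n T → Triple t n′ T′
triple-cast refl refl τ = τ

-- The path 0, 1, t + 1, t, …, 3, 2, cut before its last vertex.
triple-3 : ∀ t → Triple (2 + t) (4 + t) 3
triple-3 t = split₁ P₁ (inj₁ refl) single (blk-to refl refl cover (P₁ ⟨ inj₁ refl ⟩₂ single)) cover
  where
  open PermutationReasoning
  P₁ : Blk 0 1 (2 + t) 0 3 (0 ∷ 1 ∷ ap 1 3 (suc t)) 0 1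
  P₁ = single ⟨ inj₂ refl ⟩₂ single ⟨ inj₂ (lemma t) ⟩₃ rev (segment (2 + t) 3 t)
    where
    lemma : ∀ t → t + 3 ≡ 2 + t + 1
    lemma = solve-∀
  cover : (0 ∷ 1 ∷ ap 1 3 (suc t)) ++ 2 ∷ [] ↭ ap 1 0 (4 + t)
  cover = prep 0 (prep 1 (++-comm (ap 1 3 (suc t)) (2 ∷ [])))

even-drop : ∀ h i → let t = 2 + h * 2 in Triple t (t + (3 + i * 2)) (3 * (2 + i * 2) + 2)
even-drop h i = go refl (even-form h (3 + i * 2))
  where
  go : ∀ {β} → β ≡ 3 + i * 2 → EvenForm (2 + h * 2) β → Triple (2 + h * 2) (2 + h * 2 + (3 + i * 2)) (3 * (2 + i * 2) + 2)
  go hβ (res-even k p p′ ht refl) = ⊥-elim (*2≢1+*2 (k * suc h + p) (suc i) (trans (lemma k h p) hβ))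
    where
    lemma : ∀ k h p → (k * suc h + p) * 2 ≡ k * (2 + h * 2) + p * 2
    lemma = solve-∀
  go () (res-1 zero p ht refl)
  go hβ (res-1 (suc k) p ht refl) =
    triple-cast (cong (2 + h * 2 +_) hβ) (cong (λ i → 3 * i + 2) (+-cancelʳ-≡ 1 (suc k * (2 + h * 2)) (2 + i * 2) (trans hβ (+-comm 1 (2 + i * 2)))))
      (subst (λ t → Triple t (t + (suc k * t + 1)) (3 * (suc k * t) + 2)) (sym ht) (even-1-drop k p))
  go hβ (res-odd k p p′ ht refl) =
    triple-cast (cong (2 + h * 2 +_) hβ) (cong (λ i → 3 * i + 2) (suc-injective (trans (sym (+-suc (k * (2 + h * 2)) (2 + p * 2))) hβ)))
      (subst (λ t → Triple t (t + (k * t + (3 + p * 2))) (3 * (k * t + (2 + p * 2)) + 2)) (sym ht) (even-tall-drop k p (suc p′)))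

even-cut : ∀ h i → let t = 2 + h * 2 in Triple t (t + (1 + i * 2)) (3 * (i * 2) + 1)
even-cut h i = triple-cast (sym (+-suc _ (i * 2))) (lemma i)
  (triple-at-1 (pat-to (+-suc _ (i * 2)) refl refl (even-ends-at-1 h i)) (proj₂ (even-good h (i * 2))))
  where
  lemma : ∀ i → i * 2 * 2 + (1 + i * 2) ≡ 3 * (i * 2) + 1
  lemma = solve-∀

-- The choices for a path through a frame with p * 2 tall columns, suc p′ * 2 short ones and a final triple.
record Plan (t B p p′ c : ℕ) : Set where
  constructor plan
  field
    {m g κ κ′} : ℕ
    tall   : Cap t (suc (t + suc B)) κ
    short  : Cap t (t + suc B) κ′
    τ      : Triple t (suc (t + suc B)) m
    bound  : g ≤ p * κ + suc p′ * κ′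
    total  : c ≡ g * 2 + m

-- The pairs are filled first, so that `T` is 0 or 1 until they are exhausted; `1 ≤ m` provides for
-- odd `c`.
low : ∀ G m c → c ≤ G * 2 + m → 1 ≤ m → ∃ λ T → ∃ λ γ → T ≤ m × γ ≤ G × c ≡ γ * 2 + T
low zero m c h _ = c , 0 , h , z≤n , refl
low (suc G) m zero h _ = 0 , 0 , z≤n , z≤n , refl
low (suc G) m (suc zero) h 1≤m = 1 , 0 , 1≤m , z≤n , refl
low (suc G) m (suc (suc c)) (s≤s (s≤s h)) 1≤m with low G m c h 1≤m
... | T , γ , T≤ , γ≤ , refl = T , suc γ , T≤ , s≤s γ≤ , refl

straight-triple : ∀ {t e β} m B → Pat t (suc (m + suc B)) e β → Triple t (suc (m + suc B)) β
straight-triple {t} {e} {β} m B P = subst (λ n → Triple t (suc n) β) (sym (+-suc m B))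
  (triple-straight (subst (λ n → Pat t (suc n) e β) (+-suc m B) P))

<-half : ∀ {m n} → m * 2 ≤ 1 + n * 2 → m ≤ n
<-half {zero} _ = z≤n
<-half {suc m} {suc n} (s≤s (s≤s h)) = s≤s (<-half h)
<-half {suc m} {zero} (s≤s ())

-- The share of the pairs is `G`, their capacity `G⁺` is larger by at least 1. Hence the triple may
-- fall short of 3 (B + 1) by 2, and two triples with consecutive sums of at least 3 B + 1 serve
-- both parities of `c`.
even-plan : ∀ {t} → EvenModulus t → ∀ B p p′ c → c ≤ (p * suc B + suc p′ * B) * 2 + 3 * suc B → Plan t B p p′ c
even-plan {t} (h , ht) B p p′ c hc = plan-of (≤-<-connex c (G⁺ * 2 + suc B))
  where
  G G⁺ : ℕ
  G = p * suc B + suc p′ * B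
  G⁺ = p * (2 + B) + suc p′ * suc B
  G⁺≡ : ∀ B p p′ → p * (2 + B) + suc p′ * suc B ≡ p * suc B + suc p′ * B + (p + suc p′)
  G⁺≡ = solve-∀
  1+G≤G⁺ : suc G ≤ G⁺
  1+G≤G⁺ = ≤-trans (≤-reflexive (+-comm 1 G)) (≤-trans (+-monoʳ-≤ G (≤-trans (s≤s z≤n) (m≤n+m (suc p′) p))) (≤-reflexive (sym (G⁺≡ B p p′))))
  b≤G⁺ : suc B ≤ G⁺
  b≤G⁺ = ≤-trans (m≤m+n (suc B) (p′ * suc B)) (m≤n+m (suc p′ * suc B) (p * (2 + B)))
  tall : Cap t (suc (t + suc B)) (2 + B)
  tall = subst (λ i → Cap t i (2 + B)) (+-suc t (suc B)) (even-capacity (h , ht) (2 + B))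
  short : Cap t (t + suc B) (suc B)
  short = even-capacity (h , ht) (suc B)
  from : ∀ {T} → Triple t (suc (t + suc B)) T → ∀ γ → c ≡ γ * 2 + T → 3 * B + 1 ≤ T → Plan t B p p′ c
  from {T} τ γ refl hT = plan tall short τ (≤-trans (<-half {γ} {suc G} (+-cancelʳ-≤ (3 * B + 1) _ _ (≤-trans (+-monoʳ-≤ (γ * 2) hT) (≤-trans hc (≤-by 1 (lemma G B)))))) 1+G≤G⁺) refl
    where
    lemma : ∀ G B → G * 2 + 3 * suc B + 1 ≡ 1 + suc G * 2 + (3 * B + 1)
    lemma = solve-∀
  high : ∀ {T} → Triple t (suc (t + suc B)) T → Triple t (suc (t + suc B)) (suc T) → 3 * B + 1 ≤ T → T ≤ c → Plan t B p p′ c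
  high {T} τ τ′ hT T≤c with ∃-≤ T≤c
  ... | δ , hδ with half δ
  ...   | inj₁ (γ , refl) = from τ γ (sym hδ) hT
  ...   | inj₂ (γ , refl) = from τ′ γ (trans (sym hδ) (sym (+-suc (γ * 2) T))) (m≤n⇒m≤1+n hT)
  plan-of : c ≤ G⁺ * 2 + suc B ⊎ G⁺ * 2 + suc B < c → Plan t B p p′ c
  plan-of (inj₁ c≤) with low G⁺ (suc B) c c≤ (s≤s z≤n)
  ... | T , γ , T≤ , γ≤ , total = plan tall short (straight-triple t B (proj₂ (tall T (m≤n⇒m≤1+n T≤)))) γ≤ total
  plan-of (inj₂ c>) = by-parity (half (suc B))
    where
    c≥ : 3 * B + 4 ≤ c
    c≥ = ≤-trans (≤-trans (≤-reflexive (lemma B)) (s≤s (+-monoˡ-≤ (suc B) (*-monoˡ-≤ 2 b≤G⁺)))) c>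
      where
      lemma : ∀ B → 3 * B + 4 ≡ suc (suc B * 2 + suc B)
      lemma = solve-∀
    by-parity : (∃ λ i → suc B ≡ i * 2) ⊎ (∃ λ i → suc B ≡ 1 + i * 2) → Plan t B p p′ c
    -- The special triples exist for an odd number of long steps in the column `C`. If `suc B` is
    -- even, `suc B + 1` is taken, which fills all rows; if it is odd, `suc B` itself is taken and
    -- the remaining row is added by `lift`.
    by-parity (inj₁ (suc i , hb)) = high
      (triple-cast (trans (+-suc t _) (cong (λ b → suc (t + b)) (sym hb))) (trans (cong (λ b → 3 * b + 1) (sym hb)) (lemma B))
        (subst (λ t → Triple t (t + (1 + suc i * 2)) (3 * (suc i * 2) + 1)) (sym ht) (even-cut h (suc i))))
      (triple-cast (trans (+-suc t _) (cong (λ b → suc (t + b)) (sym hb))) (trans (cong (λ b → 3 * b + 2) (sym hb)) (lemma′ B))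
        (subst (λ t → Triple t (t + (3 + i * 2)) (3 * (2 + i * 2) + 2)) (sym ht) (even-drop h i)))
      (≤-by 3 (lemma″ B)) c≥
      where
      lemma : ∀ B → 3 * suc B + 1 ≡ 3 * B + 4
      lemma = solve-∀
      lemma′ : ∀ B → 3 * suc B + 2 ≡ suc (3 * B + 4)
      lemma′ = solve-∀
      lemma″ : ∀ B → 3 * B + 1 + 3 ≡ 3 * B + 4
      lemma″ = solve-∀
    by-parity (inj₂ (i , hb)) = high
      (triple-cast refl (cong (λ B → 3 * B + 1) (sym (suc-injective hb)))
        (lift (triple-cast (cong (t +_) (sym hb)) refl (subst (λ t → Triple t (t + (1 + i * 2)) (3 * (i * 2) + 1)) (sym ht) (even-cut h i)))))
      (triple-cast refl (trans (cong (λ B → 3 * B + 2) (sym (suc-injective hb))) (+-suc (3 * B) 1)) (second i hb))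
      ≤-refl (≤-trans (≤-by 3 (lemma″ B)) c≥)
      where
      lemma″ : ∀ B → 3 * B + 1 + 3 ≡ 3 * B + 4
      lemma″ = solve-∀
      second : ∀ i → suc B ≡ 1 + i * 2 → Triple t (suc (t + suc B)) (3 * (i * 2) + 2)
      second zero hb = straight-triple t B (proj₂ (tall 2 (s≤s (s≤s z≤n))))
      second (suc i) hb = lift (triple-cast (cong (t +_) (sym hb)) refl
        (subst (λ t → Triple t (t + (3 + i * 2)) (3 * (2 + i * 2) + 2)) (sym ht) (even-drop h i)))

-- Triples for two sums T of different parities close to the maximum 3 * suc B, either one exact or one on each side.
EvenOption OddOption : ℕ → ℕ → Set
EvenOption t B = Triple t (suc (t + suc B)) (3 * suc B)
  ⊎ ∃ λ B₂ → B ≡ 2 + B₂ × Triple t (suc (t + suc B)) (3 * suc B + 2) × Triple t (suc (t + suc B)) (3 * suc B₂ + 2)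
OddOption t B = Triple t (suc (t + suc B)) (3 * B + 2)
  ⊎ ∃ λ B₂ → B ≡ 2 + B₂ × Triple t (suc (t + suc B)) (3 * suc B + 3) × Triple t (suc (t + suc B)) (3 * B)

private
  n₂ : ∀ t β B → β ≡ suc (suc B) → t + β ≡ suc (t + suc B)
  n₂ t β B refl = +-suc t (suc B)
  n₁ : ∀ t β B → β ≡ suc B → suc (t + β) ≡ suc (t + suc B)
  n₁ t β B refl = refl
  n₀ : ∀ t β B → β ≡ B → suc (suc (t + β)) ≡ suc (t + suc B)
  n₀ t β B refl = cong suc (sym (+-suc t B))

  tall≡ : ∀ p p′ → 2 + p * 2 + (p′ * 2 + 1) ≡ 1 + p * 2 + suc p′ * 2
  tall≡ = solve-∀

  drop-even : ∀ k p p′ {t} → t ≡ 2 + p * 2 + (p′ * 2 + 1) →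
    Triple t (t + (k * t + (2 + p * 2))) (3 * (k * t + (1 + p * 2)) + 2)
  drop-even k p p′ ht = subst (λ t → Triple t (t + (k * t + (2 + p * 2))) (3 * (k * t + (1 + p * 2)) + 2)) (sym (trans ht (tall≡ p p′))) (odd-tall-drop k p (suc p′))

  drop-1 : ∀ k p {t} → t ≡ 1 + p * 2 → Triple t (t + (suc k * t + 1)) (3 * (suc k * t) + 2)
  drop-1 k p refl = odd-1-drop k p

  thrice+2 : ∀ {i j} → i ≡ j → 3 * i + 2 ≡ 3 * j + 2
  thrice+2 = cong (λ i → 3 * i + 2)

-- If paths with `suc B` long steps miss the wanted sum, the neighbouring numbers are used: `B + 2`
-- on all rows gives a sum that is too large, `B` followed by two lifts one that is too small. The
-- errors are +2 and -4 for the first target, +4 and -2 for the second; being even, they can be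
-- balanced by the pairs.
odd-options : ∀ h B → let m = 3 + h * 2 in EvenOption m B × OddOption m B
odd-options h B = options (odd-form h (suc B))
  where
  m : ℕ
  m = 3 + h * 2
  options : OddForm m (suc B) → EvenOption m B × OddOption m B
  options (res-0 zero p ht ())
  options (res-0 (suc k) p ht hb) =
    inj₂ (h * 2 + k * m , suc-injective hb ,
      triple-cast (n₂ m (suc k * m + 1) B (trans (+-comm (suc k * m) 1) (cong suc (sym hb)))) (thrice+2 (sym hb)) (drop-1 k (suc h) refl) ,
      triple-cast (trans (cong (λ i → suc (suc (m + i))) (lemma (k * m) h)) (n₀ m (2 + h * 2 + k * m) B (sym (suc-injective hb)))) (thrice+2 (lemma₁ (k * m) h))
        (lifts 2 (drop-even k h 0 (+-comm 1 (2 + h * 2))))) ,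
    inj₁ (triple-cast (n₁ m (suc k * m) B (sym hb)) (thrice+2 (sym (suc-injective hb))) (lift (odd-0-drop k (suc h) (+-comm 1 (2 + h * 2)))))
    where
    lemma : ∀ i h → i + (2 + h * 2) ≡ 2 + h * 2 + i
    lemma = solve-∀
    lemma₁ : ∀ i h → i + (1 + h * 2) ≡ suc (h * 2 + i)
    lemma₁ = solve-∀
  -- Here `B = 0`. The sum 3 comes from the special path of `triple-3`, the sum 2 from a single
  -- column with two long steps.
  options (res-1 zero p ht hb) with suc-injective hb
  ... | refl =
    inj₁ (subst (λ n → Triple m n 3) (sym (+-comm (suc m) 1)) (triple-3 (1 + h * 2))) ,
    inj₁ (straight-triple m 0 (pat-to (+-suc m 1) refl refl (subst (λ m → Pat m (m + 2) (1 + 1 * m) 2) (sym (tall h)) (odd-tall 0 0 (suc h)))))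
    where
    tall : ∀ h → 3 + h * 2 ≡ 1 + 0 * 2 + suc h * 2
    tall = solve-∀
  options (res-1 (suc k) p ht hb) =
    inj₂ (1 + h * 2 + k * m , B≡ ,
      triple-cast (n₂ m (suc k * m + 2) B (trans (+-suc (suc k * m) 1) (cong suc (sym hb)))) (thrice+2 (sym hb)) (drop-even (suc k) 0 h (+-comm 1 (2 + h * 2))) ,
      triple-cast (n₀ m (suc k * m) B (sym B≡)) (thrice+2 {2 + h * 2 + k * m} refl) (lifts 2 (odd-0-drop k (suc h) (+-comm 1 (2 + h * 2))))) ,
    inj₁ (triple-cast (n₁ m (suc k * m + 1) B (sym hb)) (thrice+2 (sym B≡)) (lift (drop-1 k (suc h) refl)))
    where
    B≡ : B ≡ suc k * m
    B≡ = suc-injective (trans hb (+-comm (suc k * m) 1))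
  options (res-even k p p′ ht hb) =
    inj₁ (triple-cast (n₁ m (k * m + (2 + p * 2)) B (sym hb)) (cong (3 *_) (sym hb)) (lift (odd-tall-split k p p′ ht))) ,
    inj₁ (triple-cast (n₁ m (k * m + (2 + p * 2)) B (sym hb)) (thrice+2 (suc-injective (trans (sym (+-suc (k * m) (1 + p * 2))) (sym hb)))) (lift (drop-even k p p′ ht)))
  options (res-odd k p p′ ht hb) =
    inj₂ (k * m + p * 2 , trans B≡ (lemma (k * m) p) ,
      triple-cast (n₂ m βʳ B β₂≡) (thrice+2 (trans (lemma₁ (k * m) p) (sym hb))) (drop-even k (suc p) p′ ht) ,
      triple-cast (n₀ m βˡ B (sym B≡)) (thrice+2 (lemma₂ (k * m) p)) (lifts 2 (drop-even k p (suc p′) ht′))) ,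
    inj₂ (k * m + p * 2 , trans B≡ (lemma (k * m) p) ,
      triple-cast (n₂ m βʳ B β₂≡) (trans (cong (3 *_) β₂≡) (lemma₃ B)) (odd-tall-split k (suc p) p′ ht) ,
      triple-cast (n₀ m βˡ B (sym B≡)) (cong (3 *_) (sym B≡)) (lifts 2 (odd-tall-split k p (suc p′) ht′)))
    where
    βˡ βʳ : ℕ
    βˡ = k * m + (2 + p * 2)
    βʳ = k * m + (2 + suc p * 2)
    B≡ : B ≡ βˡ
    B≡ = suc-injective (trans hb (+-suc (k * m) (2 + p * 2)))
    β₂≡ : βʳ ≡ suc (suc B)
    β₂≡ = trans (+-suc (k * m) (3 + p * 2)) (cong suc (sym hb))
    lemma : ∀ i p → i + (2 + p * 2) ≡ 2 + (i + p * 2)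
    lemma = solve-∀
    lemma₁ : ∀ i p → i + (1 + suc p * 2) ≡ i + (3 + p * 2)
    lemma₁ = solve-∀
    lemma₂ : ∀ i p → i + (1 + p * 2) ≡ suc (i + p * 2)
    lemma₂ = solve-∀
    lemma₃ : ∀ B → 3 * suc (suc B) ≡ 3 * suc B + 3
    lemma₃ = solve-∀
    ht′ : m ≡ 2 + p * 2 + (suc p′ * 2 + 1)
    ht′ = trans ht (lemma₄ p p′)
      where
      lemma₄ : ∀ p p′ → 2 + suc p * 2 + (p′ * 2 + 1) ≡ 2 + p * 2 + (suc p′ * 2 + 1)
      lemma₄ = solve-∀

-- Large `c` are measured by their distance `j` from the maximum. Half of `j` is taken off the
-- pairs, next to a triple with sum 3 (B + 1) if `j` is even and 3 B + 2 if it is odd. A triple that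
-- is too small is balanced by raising `γ`, which a large enough gap to `G` permits; otherwise the
-- triple that is too large is taken and `γ` is lowered.
odd-plan : ∀ {t} → OddModulus t → ∀ B p p′ c → c ≤ (p * suc B + suc p′ * B) * 2 + 3 * suc B → Plan t B p p′ c
odd-plan {t} (h , refl) B p p′ c hc = plan-of (≤-<-connex c (G * 2 + suc B))
  where
  G : ℕ
  G = p * suc B + suc p′ * B
  B≤G : B ≤ G
  B≤G = ≤-trans (m≤m+n B (p′ * B)) (m≤n+m (suc p′ * B) (p * suc B))
  tall : Cap t (suc (t + suc B)) (suc B)
  tall = capacity (s≤s (s≤s z≤n)) (suc B)
  short : Cap t (t + suc B) B
  short = subst (λ i → Cap t i B) (sym (+-suc t B)) (capacity (s≤s (s≤s z≤n)) B)
  with-gap : ∀ i γ → i + γ ≡ G → c ≡ γ * 2 + 3 * suc B → EvenOption t B → Plan t B p p′ c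
  with-gap i γ hG total (inj₁ τ) = plan tall short τ (≤-trans (m≤n+m γ i) (≤-reflexive hG)) total
  with-gap (suc (suc i)) γ hG total (inj₂ (B₂ , refl , _ , τ)) =
    plan tall short τ (≤-trans (≤-by i (lemma i γ)) (≤-reflexive hG)) (trans total (lemma′ γ B₂))
    where
    lemma : ∀ i γ → 2 + γ + i ≡ suc (suc i) + γ
    lemma = solve-∀
    lemma′ : ∀ γ B₂ → γ * 2 + 3 * suc (2 + B₂) ≡ (2 + γ) * 2 + (3 * suc B₂ + 2)
    lemma′ = solve-∀
  with-gap zero (suc γ) hG total (inj₂ (B₂ , refl , τ , _)) = plan tall short τ (≤-trans (n≤1+n γ) (≤-reflexive hG)) (trans total (lemma γ B₂))
    where
    lemma : ∀ γ B₂ → suc γ * 2 + 3 * suc (2 + B₂) ≡ γ * 2 + (3 * suc (2 + B₂) + 2)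
    lemma = solve-∀
  with-gap (suc zero) (suc γ) hG total (inj₂ (B₂ , refl , τ , _)) = plan tall short τ (≤-trans (≤-trans (n≤1+n γ) (n≤1+n (suc γ))) (≤-reflexive hG)) (trans total (lemma γ B₂))
    where
    lemma : ∀ γ B₂ → suc γ * 2 + 3 * suc (2 + B₂) ≡ γ * 2 + (3 * suc (2 + B₂) + 2)
    lemma = solve-∀
  -- Lowering `γ` fails only if `G` is tiny, but `G ≥ B`, and inexact triples occur only for
  -- `B ≥ 2`.
  with-gap zero zero hG total (inj₂ (B₂ , refl , _)) with subst (2 + B₂ ≤_) (sym hG) B≤G
  ... | ()
  with-gap (suc zero) zero hG total (inj₂ (B₂ , refl , _)) with subst (2 + B₂ ≤_) (sym hG) B≤G
  ... | s≤s ()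
  with-odd-gap : ∀ i γ → i + γ ≡ G → c ≡ γ * 2 + (3 * B + 2) → OddOption t B → Plan t B p p′ c
  with-odd-gap i γ hG total (inj₁ τ) = plan tall short τ (≤-trans (m≤n+m γ i) (≤-reflexive hG)) total
  with-odd-gap (suc i) γ hG total (inj₂ (B₂ , refl , _ , τ)) =
    plan tall short τ (≤-trans (≤-by i (+-comm (suc γ) i)) (≤-reflexive (trans (+-suc i γ) hG))) (trans total (lemma γ B))
    where
    lemma : ∀ γ B → γ * 2 + (3 * B + 2) ≡ suc γ * 2 + 3 * B
    lemma = solve-∀
  with-odd-gap zero (suc (suc γ)) hG total (inj₂ (B₂ , refl , τ , _)) =
    plan tall short τ (≤-trans (≤-trans (n≤1+n γ) (n≤1+n (suc γ))) (≤-reflexive hG)) (trans total (lemma γ B))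
    where
    lemma : ∀ γ B → suc (suc γ) * 2 + (3 * B + 2) ≡ γ * 2 + (3 * suc B + 3)
    lemma = solve-∀
  with-odd-gap zero zero hG total (inj₂ (B₂ , refl , _)) with subst (2 + B₂ ≤_) (sym hG) B≤G
  ... | ()
  with-odd-gap zero (suc zero) hG total (inj₂ (B₂ , refl , _)) with subst (2 + B₂ ≤_) (sym hG) B≤G
  ... | s≤s ()
  plan-of : c ≤ G * 2 + suc B ⊎ G * 2 + suc B < c → Plan t B p p′ c
  plan-of (inj₁ c≤) with low G (suc B) c c≤ (s≤s z≤n)
  ... | T , γ , T≤ , γ≤ , total = plan tall short (straight-triple t B (proj₂ (tall T T≤))) γ≤ total
  plan-of (inj₂ c>) with ∃-≤ hc
  ... | j , hj with half j
  ...   | inj₁ (i , refl) with ∃-≤ (≤-trans i≤B B≤G)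
    where
    i≤B : i ≤ B
    i≤B = <-half (+-cancelʳ-≤ (suc (G * 2 + suc B)) _ _ (≤-trans (+-monoʳ-≤ (i * 2) c>) (≤-trans (≤-reflexive hj) (≤-by 0 (lemma G B)))))
      where
      lemma : ∀ G B → G * 2 + 3 * suc B + 0 ≡ 1 + B * 2 + suc (G * 2 + suc B)
      lemma = solve-∀
  ...     | γ , hγ = with-gap i γ (trans (+-comm i γ) hγ) (+-cancelˡ-≡ (i * 2) _ _ (trans hj (trans (cong (λ g → g * 2 + 3 * suc B) (sym hγ)) (lemma i γ B)))) (proj₁ (odd-options h B))
    where
    lemma : ∀ i γ B → (γ + i) * 2 + 3 * suc B ≡ i * 2 + (γ * 2 + 3 * suc B)
    lemma = solve-∀
  plan-of (inj₂ c>) | j , hj | inj₂ (i , refl) with ∃-≤ (≤-trans i≤B B≤G)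
    where
    i≤B : i ≤ B
    i≤B = <-half (+-cancelʳ-≤ (suc (suc (G * 2 + suc B))) _ _ (≤-trans (≤-reflexive (lemma₁ (i * 2) (G * 2 + suc B))) (≤-trans (+-monoʳ-≤ (suc (i * 2)) c>) (≤-trans (≤-reflexive hj) (≤-by 1 (lemma G B))))))
      where
      lemma₁ : ∀ i g → i + suc (suc g) ≡ suc i + suc g
      lemma₁ = solve-∀
      lemma : ∀ G B → G * 2 + 3 * suc B + 1 ≡ 1 + B * 2 + suc (suc (G * 2 + suc B))
      lemma = solve-∀
  ...     | γ , hγ = with-odd-gap i γ (trans (+-comm i γ) hγ) (+-cancelˡ-≡ (suc (i * 2)) _ _ (trans hj (trans (cong (λ g → g * 2 + 3 * suc B) (sym hγ)) (lemma i γ B)))) (proj₂ (odd-options h B))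
    where
    lemma : ∀ i γ B → (γ + i) * 2 + 3 * suc B ≡ suc (i * 2) + (γ * 2 + (3 * B + 2))
    lemma = solve-∀

plan-exists : ∀ {t} → 2 ≤ t → ∀ B p p′ c → c ≤ (p * suc B + suc p′ * B) * 2 + 3 * suc B → Plan t B p p′ c
plan-exists 2≤t with modulus 2≤t
... | inj₁ odd = odd-plan odd
... | inj₂ even = even-plan even

-- Paths with three step lengths

Std : (x y v a c : ℕ) → Set
Std x y v a c = ∃ λ e → Blk 1 x y 0 e (ap 1 0 v) a c

std-to : ∀ {x y v v′ a a′ c c′} → v ≡ v′ → a ≡ a′ → c ≡ c′ → Std x y v a c → Std x y v′ a′ c′
std-to refl refl refl P = P

std-prefix : ∀ {x y v a c} → Std x y v a c → Std x y (suc v) (suc a) c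
std-prefix {v = v} (e , P) = suc e , single ⟨ inj₂ refl ⟩₁ blk-to refl refl (↭-reflexive (map-suc-ap 1 0 v)) (shift-block P)

std-prefixes : ∀ j {x y v a c} → Std x y v a c → Std x y (j + v) (j + a) c
std-prefixes zero P = P
std-prefixes (suc j) P = std-prefix (std-prefixes j P)

of-part : ∀ {x y e v a c} → Part x y e v [] a c → Std x y v a c
of-part P = _ , full P

tall-cap : ∀ {t} → 2 ≤ t → ∀ B → Cap t (suc (t + suc B)) (suc B)
tall-cap 2≤t B = capacity 2≤t (suc B)

short-cap : ∀ {t} → 2 ≤ t → ∀ B → Cap t (t + suc B) B
short-cap {t} 2≤t B = subst (λ i → Cap t i B) (sym (+-suc t B)) (capacity 2≤t B)

column-base : ∀ {t n e β} x s → Pat t n e β → Blk 1 x (t * x) s (s + e * x) (band x s 1 n) 0 β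
column-base x s P = blk-to refl refl (↭-reflexive (sym (++-identityʳ _))) (column x s P)

std-odd : ∀ {t} → 2 ≤ t → ∀ B p p′ {x} → x ≡ 3 + p * 2 + suc p′ * 2 → ∀ c → c ≤ B * x + (3 + p * 2) →
  Std x (t * x) (suc ((t + suc B) * x + (3 + p * 2))) x c
std-odd {t} 2≤t B p p′ {x} hx c hc with plan-exists 2≤t B p p′ c (≤-trans hc (≤-reflexive (trans (cong (λ x → B * x + (3 + p * 2)) hx) (lemma B p p′))))
  where
  lemma : ∀ B p p′ → B * (3 + p * 2 + suc p′ * 2) + (3 + p * 2) ≡ (p * suc B + suc p′ * B) * 2 + 3 * suc B
  lemma = solve-∀
... | plan tall short τ bound refl with triple-block x 1 τ
...   | e , S , Q , h = of-part (part-to refl (trans (lemma p p′) (sym hx)) refl (frame-tall (t + suc B) 3 p (suc p′) hx tall short bound Q h))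
  where
  lemma : ∀ p p′ → suc p′ * 2 + (p * 2 + 3) ≡ 3 + p * 2 + suc p′ * 2
  lemma = solve-∀

-- The unpaired column 1 is tall and carries up to `suc B` long steps, so it can always supply an
-- odd one.
std-even : ∀ {t} → 2 ≤ t → ∀ B p p′ {x} → x ≡ 1 + p * 2 + p′ * 2 → ∀ c → c ≤ B * x + (1 + p * 2) →
  Std x (t * x) (suc ((t + suc B) * x + (1 + p * 2))) (p * 2 + p′ * 2) c
std-even {t} 2≤t B p p′ {x} hx c hc with low (p * suc B + p′ * B) (suc B) c (≤-trans hc (≤-reflexive (trans (cong (λ x → B * x + (1 + p * 2)) hx) (lemma B p p′)))) (s≤s z≤n)
  where
  lemma : ∀ B p p′ → B * (1 + p * 2 + p′ * 2) + (1 + p * 2) ≡ (p * suc B + p′ * B) * 2 + suc B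
  lemma = solve-∀
... | β , γ , β≤ , γ≤ , refl with tall-cap 2≤t B β β≤
...   | e , P = of-part (part-to refl (lemma p p′) refl
  (frame-tall (t + suc B) 1 p p′ hx (tall-cap 2≤t B) (short-cap 2≤t B) γ≤ (column-base x 1 P) (↭-reflexive (++-identityʳ _))))
  where
  lemma : ∀ p p′ → p′ * 2 + (p * 2 + 0) ≡ p * 2 + p′ * 2
  lemma = solve-∀

low′ : ∀ B G c → c ≤ G * B * 2 + B → ∃ λ β → ∃ λ γ → β ≤ B × γ ≤ G * B × c ≡ γ * 2 + β
low′ (suc B) G c h = low (G * suc B) (suc B) c h (s≤s z≤n)
low′ zero G c h = 0 , 0 , z≤n , z≤n , n≤0⇒n≡0 (≤-trans h (≤-reflexive (cong (λ i → i * 2 + 0) (*-zeroʳ G))))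

std-1 : ∀ {t} → 2 ≤ t → ∀ B p {x} → x ≡ 1 + p * 2 → ∀ c → c ≤ B * x → Std x (t * x) (suc ((t + suc B) * x)) (p * 2) c
std-1 {t} 2≤t B p {x} hx c hc with low′ B p c (≤-trans hc (≤-reflexive (trans (cong (B *_) hx) (lemma B p))))
  where
  lemma : ∀ B p → B * (1 + p * 2) ≡ p * B * 2 + B
  lemma = solve-∀
... | β , γ , β≤ , γ≤ , refl with short-cap 2≤t B β β≤
...   | e , P = of-part (part-to refl (+-identityʳ (p * 2)) refl
  (frame-short (t + suc B) 1 p hx (short-cap 2≤t B) γ≤ (column-base x 1 P) (↭-reflexive (++-identityʳ _))))

-- The unpaired column is short and carries at most `B` long steps, possibly none. Parity is
-- therefore not always free, and the split into `γ` and `β` is left to the caller.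
std-right : ∀ {t} → 2 ≤ t → ∀ B p p′ {x} → x ≡ p * 2 + (p′ * 2 + 1) → ∀ β γ → β ≤ B → γ ≤ p * suc B + p′ * B →
  Std x (t * x) ((t + suc B) * x + p * 2) (p * 2 + p′ * 2) (γ * 2 + β)
std-right {t} 2≤t B p p′ {x} hx β γ β≤ γ≤ with short-cap 2≤t B β β≤
... | e , P = of-part (part-to refl (cong (p * 2 +_) (+-identityʳ (p′ * 2))) refl
  (frame-right (t + suc B) 1 p p′ hx (tall-cap 2≤t B) (short-cap 2≤t B) γ≤ (column-base x _ P) (↭-reflexive (++-identityʳ _))))

-- Here b = t x, a = x, and the columns of 0 and 1 are the long ones: the former is left after its first vertex and
-- re-entered from the latter.
std-bump : ∀ {t} → 2 ≤ t → ∀ B p {x} → x ≡ 3 + p * 2 → Std x (t * x) ((t + (2 + B)) * x + 2) x (suc B * x + 1)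
std-bump {t} 2≤t B p {x} hx with bump 2≤t (2 + B) (s≤s z≤n) | low′ (suc B) p (p * suc B * 2 + B) (+-monoʳ-≤ (p * suc B * 2) (n≤1+n B))
... | e , β , β′ , P , P′ , hβ | β″ , γ , β≤ , γ≤ , hc with short-cap 2≤t (suc B) β″ β≤
...   | e″ , P″ = _ , blk-to (trans (cong (3 +_) (+-identityʳ (p * 2))) (sym hx)) total cover
  (single ⟨ inj₂ refl ⟩₁ column x 1 P′
    ⟨ inj₁ refl ⟩₁ rev (column x x P)
    ⟨ inj₁ (trans hx (lemma p)) ⟩₁ pairsˡ (short-cap 2≤t (suc B)) p γ≤ (column x 2 P″))
  where
  q : ℕ
  q = t + (2 + B)
  lemma : ∀ p → 3 + p * 2 ≡ 1 + (p * 2 + 2)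
  lemma = solve-∀
  total : β′ + (β + (γ * 2 + β″)) ≡ suc B * x + 1
  total = trans (lemma₁ β β′ (γ * 2 + β″)) (trans (cong₂ _+_ hβ (sym hc)) (trans (lemma₂ B p) (cong (λ x → suc B * x + 1) (sym hx))))
    where
    lemma₁ : ∀ β β′ g → β′ + (β + g) ≡ β + β′ + g
    lemma₁ = solve-∀
    lemma₂ : ∀ B p → (2 + B) * 2 + (p * suc B * 2 + B) ≡ suc B * (3 + p * 2) + 1
    lemma₂ = solve-∀
  C₀ C₁ C₂ U : List ℕ
  C₀ = ap x x q
  C₁ = ap x 1 (suc q)
  C₂ = ap x 2 q
  U = band x 3 (p * 2) q
  open PermutationReasoning
  cover : 0 ∷ (C₁ ++ (C₀ ++ (U ++ C₂))) ↭ ap 1 0 (q * x + 2)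
  cover = begin
    0 ∷ (C₁ ++ (C₀ ++ (U ++ C₂)))               ↭⟨ prep 0 (shifts C₁ C₀) ⟩
    0 ∷ (C₀ ++ (C₁ ++ (U ++ C₂)))               ↭⟨ prep 0 (++⁺ˡ C₀ (++⁺ˡ C₁ (++-comm U C₂))) ⟩
    0 ∷ (C₀ ++ (C₁ ++ (C₂ ++ U)))               ≡⟨ cong₂ (λ i j → 0 ∷ (ap x i q ++ (j ++ (C₂ ++ U)))) (sym (+-identityʳ x)) (sym (++-identityʳ C₁)) ⟩
    0 ∷ (ap x (x + 0) q ++ ((C₁ ++ []) ++ (C₂ ++ U))) ≡⟨ cong (0 ∷_) (sym (++-assoc (ap x (x + 0) q) (C₁ ++ []) _)) ⟩
    band x 0 2 (suc q) ++ band x 2 (1 + p * 2) q ≡⟨ cong (λ x → band x 0 2 (suc q) ++ band x 2 (1 + p * 2) q) hx ⟩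
    band (3 + p * 2) 0 2 (suc q) ++ band (3 + p * 2) 2 (1 + p * 2) q ↭⟨ grid 2 (1 + p * 2) 0 q ⟩
    ap 1 0 (q * (3 + p * 2) + 2)                ≡⟨ cong (λ x → ap 1 0 (q * x + 2)) (sym hx) ⟩
    ap 1 0 (q * x + 2)                          ∎

row : ∀ x y s n → Blk 1 x y s (n + s) (ap 1 s (suc n)) n 0
row x y s zero = single
row x y s (suc n) = single ⟨ inj₂ refl ⟩₁ blk-at refl (+-suc n s) (row x y (suc s) n)

-- The lowest row is walked horizontally, and of the columns above it only the last one visited,
-- with `t + 1` rows, contains a long step. Row and columns take `x - 1` steps of length 1 each.
std-row : ∀ {t} → 2 ≤ t → ∀ p {x} → x ≡ 1 + p * 2 → Std x (t * x) ((2 + t) * x) (p * 2 + p * 2) 1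
std-row {t} 2≤t p {x} hx with good-or-bad 2≤t 1
... | inj₂ (zero , p₁ , p₂ , ht , ())
... | inj₂ (suc k , p₁ , p₂ , refl , ())
... | inj₁ (e , P) = _ , blk-to (cong (p * 2 +_) (+-identityʳ (p * 2))) refl cover
  (row x (t * x) 0 (p * 2) ⟨ inj₂ (lemma x (p * 2)) ⟩₂
    pairsˡ (subst (λ i → Cap t i 0) (+-comm 1 t) (straights t t)) p z≤n (column x x P))
  where
  lemma : ∀ x p → p + x ≡ x + (p + 0)
  lemma = solve-∀
  rows : ℕ
  rows = t + 1
  U C : List ℕ
  U = band x (suc x) (p * 2) rows
  C = ap x x rows
  open PermutationReasoning
  cover : ap 1 0 (suc (p * 2)) ++ (U ++ C) ↭ ap 1 0 ((2 + t) * x)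
  cover = begin
    ap 1 0 (suc (p * 2)) ++ (U ++ C)      ↭⟨ ++⁺ˡ (ap 1 0 (suc (p * 2))) (++-comm U C) ⟩
    ap 1 0 (suc (p * 2)) ++ band x x (suc (p * 2)) rows ≡⟨ cong (λ i → ap 1 0 i ++ band x x i rows) (sym hx) ⟩
    ap 1 0 x ++ band x x x rows              ↭⟨ ++⁺ˡ (ap 1 0 x) (grid 0 x x rows) ⟩
    ap 1 0 x ++ ap 1 x (rows * x + 0)        ≡⟨ cong (λ i → ap 1 0 x ++ ap 1 i (rows * x + 0)) (lemma₁ x) ⟩
    ap 1 0 x ++ ap 1 (x * 1 + 0) (rows * x + 0) ≡⟨ sym (ap-++ 1 0 x (rows * x + 0)) ⟩
    ap 1 0 (x + (rows * x + 0))              ≡⟨ cong (ap 1 0) (lemma₂ t x) ⟩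
    ap 1 0 ((2 + t) * x)                  ∎
    where
    lemma₁ : ∀ x → x ≡ x * 1 + 0
    lemma₁ = solve-∀
    lemma₂ : ∀ t x → x + ((t + 1) * x + 0) ≡ (2 + t) * x
    lemma₂ = solve-∀

-- Realizations as routes, and the values of ω

dist-Adj : Adj d u w → ∣ u - w ∣ ≡ d
dist-Adj {d} {w = w} (inj₁ refl) = trans (cong₂ _+_ (m+n∸n≡m d w) (m≤n⇒m∸n≡0 (m≤n+m w d))) (+-identityʳ d)
dist-Adj {d} {u = u} (inj₂ refl) = cong₂ _+_ (m≤n⇒m∸n≡0 (m≤n+m u d)) (m+n∸n≡m d u)

Adj-dist : ∣ u - w ∣ ≡ d → Adj d u w
Adj-dist {u} {w} refl with ≤-total u w
... | inj₁ u≤w = inj₂ (trans (sym (m∸n+n≡m u≤w)) (cong (λ i → i + (w ∸ u) + u) (sym (m≤n⇒m∸n≡0 u≤w))))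
... | inj₂ w≤u = inj₁ (trans (sym (m∸n+n≡m w≤u)) (cong (_+ w) (trans (sym (+-identityʳ (u ∸ w))) (cong ((u ∸ w) +_) (sym (m≤n⇒m∸n≡0 w≤u))))))

route-head : Route k₁ k₂ k₃ u e L a b c → ∃ λ L′ → L ≡ u ∷ L′
route-head stop = _ , refl
route-head (step₁ _ _) = _ , refl
route-head (step₂ _ _) = _ , refl
route-head (step₃ _ _) = _ , refl

edges-step : Adj d u w → Route k₁ k₂ k₃ w e L a b c → edgeLengths (u ∷ L) ≡ d ∷ edgeLengths L
edges-step p r with route-head r
... | L′ , refl = cong (_∷ _) (dist-Adj p)

route-edges : Route k₁ k₂ k₃ u e L a b c → edgeLengths L ↭ replicate a k₁ ++ replicate b k₂ ++ replicate c k₃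
route-edges stop = ↭-refl
route-edges (step₁ p r) = ↭-trans (↭-reflexive (edges-step p r)) (prep _ (route-edges r))
route-edges (step₂ {a = a} p r) = ↭-trans (↭-reflexive (edges-step p r)) (↭-trans (prep _ (route-edges r)) (↭-sym (shift _ (replicate a _) _)))
route-edges (step₃ {a = a} {b = b} p r) = ↭-trans (↭-reflexive (edges-step p r)) (↭-trans (prep _ (route-edges r))
  (↭-trans (↭-sym (shift _ (replicate a _) _)) (++⁺ˡ (replicate a _) (↭-sym (shift _ (replicate b _) _)))))

realization : ∀ {L₀ v} → Route k₁ k₂ k₃ 0 e L a b c → L ↭ ap 1 0 (suc v) → length L₀ ≡ v →
  replicate a k₁ ++ replicate b k₂ ++ replicate c k₃ ↭ L₀ → HasStdLinReal L₀
realization r p refl q with route-head r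
... | L′ , refl = L′ , ↭-trans p (↭-reflexive (sym (upTo≡ap _))) , ↭-trans (route-edges r) q

mids-≡ : ∀ {v} → Route k₁ k₂ k₃ u e L a b c → L ↭ ap 1 0 v → v ≡ suc (a + d + c) → b ≡ d
mids-≡ {a = a} {b} {c} {d} {v} r p hv = +-cancelˡ-≡ a b d (+-cancelʳ-≡ c (a + b) (a + d) (suc-injective
  (trans (sym (route-length r)) (trans (↭-length p) (trans (length-ap 1 0 v) hv)))))

realize : ∀ a b c → Std x (t * x) (suc (a + b + c)) a c → HasStdLinReal (multL a b c x t)
realize {x} {t} a b c (e , blk r p) with mids-≡ {d = b} r p refl
... | refl = realization r p
  (trans (length-++ (replicate a 1)) (trans (cong₂ _+_ (length-replicate a) (trans (length-++ (replicate b x)) (cong₂ _+_ (length-replicate b) (length-replicate c)))) (sym (+-assoc a b c))))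
  ↭-refl

realize₂ : ∀ a d → Std x y (suc (a + d)) a 0 → HasStdLinReal (oneZ a x d)
realize₂ {x} a d (e , blk r p) with mids-≡ {d = d} r p (cong suc (sym (+-identityʳ (a + d))))
... | refl = realization r p (trans (length-++ (replicate a 1)) (cong₂ _+_ (length-replicate a) (length-replicate d)))
  (↭-reflexive (cong (replicate a 1 ++_) (++-identityʳ _)))

sum-replicate : ∀ n k → sum (replicate n k) ≡ n * k
sum-replicate zero k = refl
sum-replicate (suc n) k = cong (k +_) (sum-replicate n k)

route-of : ∀ u p → All (λ k → k ≡ 1 ⊎ k ≡ z) (edgeLengths (u ∷ p)) → ∃ λ e → ∃ λ a → ∃ λ b → Route 1 z 0 u e (u ∷ p) a b 0
route-of u [] [] = u , 0 , 0 , stop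
route-of u (w ∷ p) (h ∷ hs) with route-of w p hs | h
... | e , a , b , r | inj₁ h₁ = e , suc a , b , step₁ (Adj-dist h₁) r
... | e , a , b , r | inj₂ h₂ = e , a , suc b , step₂ (Adj-dist h₂) r

-- Length and sum of the multiset are two independent linear equations for the multiplicities, as
-- `z` differs from 1.
split-counts : ∀ {z} → 1 < z → ∀ a b a′ b′ → replicate a 1 ++ replicate b z ↭ replicate a′ 1 ++ replicate b′ z → a ≡ a′ × b ≡ b′
split-counts {suc zero} (s≤s ())
split-counts {suc (suc z)} _ a b a′ b′ p = a≡ , b≡
  where
  Z : ℕ
  Z = suc (suc z)
  len : a + b ≡ a′ + b′
  len = trans (sym (count a b)) (trans (↭-length p) (count a′ b′))
    where
    count : ∀ a b → length (replicate a 1 ++ replicate b Z) ≡ a + b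
    count a b = trans (length-++ (replicate a 1)) (cong₂ _+_ (length-replicate a) (length-replicate b))
  total : a + b + b * suc z ≡ a′ + b′ + b′ * suc z
  total = trans (sym (weigh a b)) (trans (sum-↭ p) (weigh a′ b′))
    where
    lemma : ∀ a b z → a * 1 + b * suc (suc z) ≡ a + b + b * suc z
    lemma = solve-∀
    weigh : ∀ a b → sum (replicate a 1 ++ replicate b Z) ≡ a + b + b * suc z
    weigh a b = trans (sum-++ (replicate a 1) (replicate b Z)) (trans (cong₂ _+_ (sum-replicate a 1) (sum-replicate b Z)) (lemma a b z))
  b≡ : b ≡ b′
  b≡ = *-cancelʳ-≡ b b′ (suc z) (+-cancelˡ-≡ (a + b) _ _ (trans total (cong (_+ b′ * suc z) (sym len))))
  a≡ : a ≡ a′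
  a≡ = +-cancelʳ-≡ b a a′ (trans len (cong (a′ +_) (sym b≡)))

route-of-realization : 1 < z → ∀ a d → HasStdLinReal (oneZ a z d) → ∃ λ e → ∃ λ L → Route 1 z 0 0 e L a d 0 × L ↭ ap 1 0 (suc (a + d))
route-of-realization {z} 1<z a d (p , hp , hL) with route-of {z = z} 0 p (All-resp-↭ (↭-sym hL) (All-++⁺ (replicate⁺ a (inj₁ refl)) (replicate⁺ d (inj₂ refl))))
... | e , a′ , d′ , r with split-counts 1<z a′ d′ a d (↭-trans (↭-reflexive (cong (replicate a′ 1 ++_) (sym (++-identityʳ _)))) (↭-trans (↭-sym (route-edges r)) hL))
...   | refl , refl = e , 0 ∷ p , r , ↭-trans hp (↭-reflexive (trans (upTo≡ap _) (cong (λ n → ap 1 0 (suc n))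
    (trans (length-++ (replicate a 1)) (cong₂ _+_ (length-replicate a) (length-replicate d))))))

-- Lower bounds for the number of steps of length 1

module Residues (x : ℕ) .{{_ : NonZero x}} where

  res : ∀ {j} i → j < x → (j + i * x) % x ≡ j
  res {j} i j<x = trans ([m+kn]%n≡m%n j i x) (m<n⇒m%n≡m j<x)

  res-+ : ∀ w → (x + w) % x ≡ w % x
  res-+ w = trans (cong (_% x) (trans (+-comm x w) (cong (w +_) (sym (*-identityˡ x))))) ([m+kn]%n≡m%n w 1 x)

  Adj-res : Adj x u w → u % x ≡ w % x
  Adj-res {w = w} (inj₁ refl) = res-+ w
  Adj-res {u = u} (inj₂ refl) = sym (res-+ u)

  -- Only a step of length 1 changes the residue class modulo `x`, so each such step adds at most
  -- one class to the list.
  residues : Route 1 x y u e L a b 0 → ∃ λ R → length R ≡ suc a × u % x ∈ R × (∀ {w} → w ∈ L → w % x ∈ R)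
  residues {u = u} stop = u % x ∷ [] , refl , here refl , λ { (here refl) → here refl }
  residues {u = u} (step₁ _ r) with residues r
  ... | R , len , _ , h = u % x ∷ R , cong suc len , here refl , λ { (here refl) → here refl ; (there p) → there (h p) }
  residues {u = u} (step₂ q r) with residues r
  ... | R , len , hd , h = R , len , hd′ , λ { (here refl) → hd′ ; (there p) → h p }
    where hd′ = subst (_∈ R) (sym (Adj-res q)) hd

pigeonhole-≤ : ∀ n lo R → (∀ i → i < n → lo + i ∈ R) → n ≤ length R
pigeonhole-≤ n lo R h = injective⇒≤ {f = λ i → index (mem i)} inj
  where
  mem : (i : Fin n) → lo + toℕ i ∈ R
  mem i = h (toℕ i) (toℕ<n i)
  inj : ∀ {i j : Fin n} → index (mem i) ≡ index (mem j) → i ≡ j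
  inj {i} {j} eq = toℕ-injective (+-cancelˡ-≡ lo _ _ (trans (lookup-index (mem i)) (trans (cong (lookup R) eq) (sym (lookup-index (mem j))))))

∈-ap⁺ : ∀ s n → s ≤ w → w < s + n → w ∈ ap 1 s n
∈-ap⁺ {w} s zero s≤w w< = ⊥-elim (<-irrefl refl (≤-trans w< (≤-trans (≤-reflexive (+-identityʳ s)) s≤w)))
∈-ap⁺ {w} s (suc n) s≤w w< with s ≟ w
... | yes refl = here refl
... | no s≢w = there (∈-ap⁺ (suc s) n (≤∧≢⇒< s≤w s≢w) (subst (w <_) (+-suc s n) w<))

few-ones : ∀ {x a d v} → 1 < x → x ≤ v → Route 1 x 0 0 e L a d 0 → L ↭ ap 1 0 v → x ≤ suc a
few-ones {x = suc x₁} {a} {d} {v} 1<x x≤v r p with Residues.residues (suc x₁) r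
... | R , len , _ , h = subst (suc x₁ ≤_) len (pigeonhole-≤ (suc x₁) 0 R λ i i<x →
    subst (_∈ R) (m<n⇒m%n≡m i<x) (h (∈-resp-↭ (↭-sym p) (∈-ap⁺ 0 v z≤n (≤-trans i<x x≤v)))))

Unique-resp-↭ : L ↭ L′ → Unique L → Unique L′
Unique-resp-↭ Perm.refl h = h
Unique-resp-↭ (prep _ p) (h ∷ hs) = All-resp-↭ p h ∷ Unique-resp-↭ p hs
Unique-resp-↭ (swap _ _ p) ((h₁ ∷ h₂) ∷ (h₃ ∷ hs)) = (≢-sym h₁ ∷ All-resp-↭ p h₃) ∷ (All-resp-↭ p h₂ ∷ Unique-resp-↭ p hs)
Unique-resp-↭ (Perm.trans p q) h = Unique-resp-↭ q (Unique-resp-↭ p h)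

Unique-ap : ∀ s n → Unique (ap 1 s n)
Unique-ap s zero = []
Unique-ap s (suc n) = All.tabulate (λ h → <⇒≢ (proj₁ (∈-ap (suc s) n h))) ∷ Unique-ap (suc s) n

Unique-++⁻ : ∀ L → Unique (L ++ L′) → Unique L × Unique L′
Unique-++⁻ [] h = [] , h
Unique-++⁻ (w ∷ L) (h ∷ hs) with Unique-++⁻ L hs
... | p , q = (++⁻ˡ L h ∷ p) , q

Unique-head : Unique (u ∷ L) → u ∉ L
Unique-head (h ∷ _) p = All.lookup h p refl

record Peeled (x u e : ℕ) (L : List ℕ) (a : ℕ) : Set where
  constructor peeled
  field
    {run rest} : List ℕ
    {last next m m′} : ℕ
    split : L ≡ run ++ rest
    along : Route 1 x 0 u last run 0 m 0
    turn  : Adj 1 last next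
    after : Route 1 x 0 next e rest a m′ 0

peel : ∀ {x} → Route 1 x 0 u e L (suc a) b 0 → Peeled x u e L a
peel (step₁ p r) = peeled refl stop p r
peel (step₂ p r) with peel r
... | peeled split along turn after = peeled (cong (_ ∷_) split) (step₂ p along) turn after

start-∈ : Route k₁ k₂ k₃ u e L a b c → u ∈ L
start-∈ stop = here refl
start-∈ (step₁ _ _) = here refl
start-∈ (step₂ _ _) = here refl
start-∈ (step₃ _ _) = here refl

-- Read `s ⊳ u` as: `s` is the next vertex beyond `u`. A vertical run that starts with nothing
-- behind it can never turn, since turning would repeat a vertex; so nothing lies beyond its end.
-- The direction is abstract because it is used upwards and downwards.
no-successor : ∀ {x} (_⊳_ : ℕ → ℕ → Set) → (∀ {u w} → Adj x u w → w ⊳ u ⊎ u ⊳ w) → (∀ {s u w} → s ⊳ u → s ⊳ w → u ≡ w) →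
  Route 1 x 0 u w V 0 b 0 → Unique V → (∀ {s} → u ⊳ s → s ∉ V) → ∀ {s} → s ⊳ w → s ∉ V
no-successor _⊳_ dir inj stop hV pred s⊳w (here refl) = pred s⊳w (here refl)
no-successor _⊳_ dir inj (step₂ p r) hV@(_ ∷ hV′) pred s⊳w s∈ with dir p
... | inj₂ back = pred back (there (start-∈ r))
no-successor _⊳_ dir inj (step₂ p r) hV@(_ ∷ hV′) pred s⊳w (here refl) | inj₁ fwd = pred s⊳w (there (end-∈ r))
no-successor _⊳_ dir inj (step₂ p r) hV@(_ ∷ hV′) pred s⊳w (there s∈) | inj₁ fwd =
  no-successor _⊳_ dir inj r hV′ (λ {s} q s∈ → Unique-head hV (subst (_∈ _) (inj q fwd) s∈)) s⊳w s∈

previous : ∀ {x} → Route 1 x 0 u w V 0 b 0 → y ∈ V → y ≡ u ⊎ ∃ λ y′ → y′ ∈ V × Adj x y′ y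
previous stop (here refl) = inj₁ refl
previous (step₂ p r) (here refl) = inj₁ refl
previous (step₂ p r) (there h) with previous r h
... | inj₁ refl = inj₂ (_ , here refl , p)
... | inj₂ (y′ , h′ , q) = inj₂ (y′ , there h′ , q)

-- A run that first goes up reaches the top of the class and is stuck there, with the vertex below
-- already used. A run that first goes down could enter the upper neighbour only from the start,
-- which is used, or from above, where there is nothing.
interior-start : ∀ {x} → Route 1 (suc x) 0 (suc x + s) w V 0 b 0 → Unique V → s ∈ V → suc x + (suc x + s) ∈ V →
  suc x + (suc x + (suc x + s)) ∉ V → ⊥
interior-start {s} {x = x} stop hV (here h) _ _ = m≢1+n+m s h
interior-start {s} {x = x} stop hV (there ()) _ _
interior-start {s} {x = x} (step₂ p r) hV (here h) hu htop = m≢1+n+m s h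
interior-start {s} {x = x} (step₂ p r) hV (there hs) (here h) htop = m≢1+n+m (suc x + s) (sym h)
interior-start {s} {x = x} (step₂ (inj₂ refl) stop) hV (there (here h)) (there _) htop = m≢1+n+m s (trans h (lemma x s))
  where
  lemma : ∀ x s → suc x + (suc x + s) ≡ suc (x + suc x) + s
  lemma = solve-∀
interior-start {s} {x = x} (step₂ (inj₂ refl) (step₂ p r)) hV (there hs) (there _) htop with p
... | inj₁ h = Unique-head hV (there (subst (_∈ _) (sym (+-cancelˡ-≡ (suc x) _ _ h)) (start-∈ r)))
... | inj₂ refl = htop (there (there (start-∈ r)))
interior-start {s} {x = x} (step₂ (inj₁ h) r) hV (there hs) (there hu) htop with previous r hu
... | inj₁ h′ = m≢1+n+m s (trans (+-cancelˡ-≡ (suc x) _ _ h) (trans (sym h′) (lemma x s)))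
  where
  lemma : ∀ x s → suc x + (suc x + s) ≡ suc (x + suc x) + s
  lemma = solve-∀
... | inj₂ (y′ , hy , inj₁ refl) = htop (there hy)
... | inj₂ (y′ , hy , inj₂ h′) = Unique-head hV (subst (_∈ _) (sym (+-cancelˡ-≡ (suc x) _ _ h′)) hy)

interior-start′ : ∀ x .{{_ : NonZero x}} → Route 1 x 0 (x + s) w V 0 b 0 → Unique V → s ∈ V → x + (x + s) ∈ V →
  x + (x + (x + s)) ∉ V → ⊥
interior-start′ (suc x) = interior-start

-- With only x - 1 steps of length 1 each residue class modulo x is visited in a single run, which has to lead from
-- one end of the class to the other. So the walk is forced once its first step of length 1 is chosen, and when the number
-- r of long classes is odd and at least 3 it gets stuck at the border between long and short classes.
module Rigid (x r k : ℕ) .{{_ : NonZero x}} (r≤x : r ≤ x) where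

  q v : ℕ
  q = 2 + k
  v = q * x + r

  open Residues x

  -- The invariant of the walk: from `u` on it covers exactly the classes `lo, …, lo + a`, with only
  -- `a` steps of length 1 left.
  record Remaining (lo a u : ℕ) : Set where
    constructor remaining
    field
      {end}    : ℕ
      {visited}      : List ℕ
      {mids}   : ℕ
      route    : Route 1 x 0 u end visited a mids 0
      unique   : Unique visited
      sound    : ∀ {w} → w ∈ visited → w < v × lo ≤ w % x × w % x < lo + suc a
      complete : ∀ {w} → w < v → lo ≤ w % x → w % x < lo + suc a → w ∈ visited

  record Run (lo a u : ℕ) : Set where
    constructor run
    field
      {swept others}     : List ℕ
      {last next end ℓ ℓ′} : ℕ
      along     : Route 1 x 0 u last swept 0 ℓ 0
      uniqueV   : Unique swept
      soundV    : ∀ {w} → w ∈ swept → w < v × w % x ≡ u % x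
      completeV : ∀ {w} → w < v → w % x ≡ u % x → w ∈ swept
      turn      : Adj 1 last next
      after     : Route 1 x 0 next end others a ℓ′ 0
      uniqueL   : Unique others
      soundL    : ∀ {w} → w ∈ others → (w < v × lo ≤ w % x × w % x < lo + (2 + a)) × ¬ w % x ≡ u % x
      completeL : ∀ {w} → w < v → lo ≤ w % x → w % x < lo + (2 + a) → ¬ w % x ≡ u % x → w ∈ others

  vertical-res : ∀ {u w V b} → Route 1 x 0 u w V 0 b 0 → ∀ {y} → y ∈ V → y % x ≡ u % x
  vertical-res stop (here refl) = refl
  vertical-res (step₂ p r) (here refl) = refl
  vertical-res (step₂ p r) (there h) = trans (vertical-res r h) (sym (Adj-res p))

  x≤v : x ≤ v
  x≤v = ≤-trans (m≤m+n x (suc k * x)) (m≤m+n (q * x) r)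

  -- If the class of `u` were visited again, the walk after its first step of length 1 would meet
  -- all `2 + a` classes with only `a` such steps, against `residues`.
  run-of : lo + (2 + a) ≤ x → Remaining lo (suc a) u → Run lo a u
  run-of {lo} {a} {u} lo≤ (remaining route unique sound complete) with peel route
  ... | peeled {V} {L} refl along turn after = run along (proj₁ (Unique-++⁻ V unique))
      (λ w∈ → proj₁ (sound (∈-++⁺ˡ w∈)) , vertical-res along w∈) completeV
      turn after (proj₂ (Unique-++⁻ V unique))
      (λ w∈ → sound (∈-++⁺ʳ V w∈) , left w∈) completeL
    where
    left : ∀ {w} → w ∈ L → ¬ w % x ≡ u % x
    left {w} w∈ hw with residues after
    ... | R , len , _ , res∈ = 1+n≰n (subst (2 + a ≤_) len (pigeonhole-≤ (2 + a) lo R every))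
      where
      every : ∀ i → i < 2 + a → lo + i ∈ R
      every i i< with ∈-++⁻ V (complete (≤-trans lo+i<x x≤v) (subst (lo ≤_) (sym lo+i%) (m≤m+n lo i)) (subst (_< lo + (2 + a)) (sym lo+i%) (+-monoʳ-< lo i<)))
        where
        lo+i<x : lo + i < x
        lo+i<x = ≤-trans (+-monoʳ-< lo i<) lo≤
        lo+i% : (lo + i) % x ≡ lo + i
        lo+i% = m<n⇒m%n≡m lo+i<x
      ... | inj₁ y∈ = subst (_∈ R) (trans hw (trans (sym (vertical-res along y∈)) (m<n⇒m%n≡m (≤-trans (+-monoʳ-< lo i<) lo≤)))) (res∈ w∈)
      ... | inj₂ y∈ = subst (_∈ R) (m<n⇒m%n≡m (≤-trans (+-monoʳ-< lo i<) lo≤)) (res∈ y∈)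
    start : ∀ {w} → w % x ≡ u % x → lo ≤ w % x × w % x < lo + (2 + a)
    start hw = subst (λ i → lo ≤ i × i < lo + (2 + a)) (sym hw) (proj₂ (sound (start-∈ route)))
    completeV : ∀ {w} → w < v → w % x ≡ u % x → w ∈ V
    completeV w<v hw with ∈-++⁻ V (complete w<v (proj₁ (start hw)) (proj₂ (start hw)))
    ... | inj₁ w∈ = w∈
    ... | inj₂ w∈ = ⊥-elim (left w∈ hw)
    completeL : ∀ {w} → w < v → lo ≤ w % x → w % x < lo + (2 + a) → ¬ w % x ≡ u % x → w ∈ L
    completeL w<v p p′ hw with ∈-++⁻ V (complete w<v p p′)
    ... | inj₁ w∈ = ⊥-elim (hw (vertical-res along w∈))
    ... | inj₂ w∈ = w∈

  drop-first : (ρ : Run lo a u) → u % x ≡ lo → Remaining (suc lo) a (Run.next ρ)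
  drop-first {lo} {a} {u} ρ hu = remaining (Run.after ρ) (Run.uniqueL ρ)
    (λ {w} w∈ → let ((p , p₁ , p₂) , p₃) = Run.soundL ρ w∈ in p , ≤∧≢⇒< p₁ (λ e → p₃ (trans (sym e) (sym hu))) , subst (w % x <_) (+-suc lo (suc a)) p₂)
    (λ {w} p p₁ p₂ → Run.completeL ρ p (<⇒≤ p₁) (subst (w % x <_) (sym (+-suc lo (suc a))) p₂) (λ e → <⇒≢ p₁ (sym (trans e hu))))

  drop-last-residue : (ρ : Run lo a u) → u % x ≡ lo + suc a → Remaining lo a (Run.next ρ)
  drop-last-residue {lo} {a} {u} ρ hu = remaining (Run.after ρ) (Run.uniqueL ρ)
    (λ {w} w∈ → let ((p , p₁ , p₂) , p₃) = Run.soundL ρ w∈ in p , p₁ , ≤∧≢⇒< (≤-pred (subst (w % x <_) (+-suc lo (suc a)) p₂)) (λ e → p₃ (trans e (sym hu))))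
    (λ {w} p p₁ p₂ → Run.completeL ρ p p₁ (<-trans p₂ (+-monoʳ-< lo (n<1+n (suc a)))) (λ e → <⇒≢ p₂ (trans e hu)))

  up-end : (ρ : Run lo a u) → u < x → Run.last ρ < v × v ≤ x + Run.last ρ × Run.last ρ % x ≡ u
  up-end {lo} {a} {u} ρ u<x = proj₁ (soundV end∈) , ≮⇒≥ top , trans (proj₂ (soundV end∈)) (m<n⇒m%n≡m u<x)
    where
    open Run ρ
    end∈ : last ∈ swept
    end∈ = end-∈ along
    top : ¬ x + last < v
    top h = no-successor (λ s w → s ≡ x + w) (λ { (inj₁ p) → inj₂ p ; (inj₂ p) → inj₁ p }) (λ p p′ → +-cancelˡ-≡ x _ _ (trans (sym p) p′))
      along uniqueV (λ { {s} refl _ → <⇒≱ u<x (m≤m+n x s) }) refl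
      (completeV h (trans (res-+ last) (proj₂ (soundV end∈))))

  down-end : (ρ : Run lo a u) → v ≤ x + u → Run.last ρ ≡ u % x
  down-end {lo} {a} {u} ρ v≤ = trans (sym (m<n⇒m%n≡m (≰⇒> bottom))) (proj₂ (soundV end∈))
    where
    open Run ρ
    end∈ : last ∈ swept
    end∈ = end-∈ along
    bottom : ¬ x ≤ last
    bottom h = no-successor (λ s w → w ≡ x + s) (λ p → p) (λ p p′ → trans p (sym p′))
      along uniqueV (λ { refl s∈ → <⇒≱ (proj₁ (soundV s∈)) v≤ }) last≡
      (completeV (≤-trans (s≤s (m∸n≤m last x)) (proj₁ (soundV end∈)))
        (trans (trans (sym (res-+ (last ∸ x))) (cong (_% x) (sym last≡))) (proj₂ (soundV end∈))))
      where
      last≡ : last ≡ x + (last ∸ x)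
      last≡ = sym (m+[n∸m]≡n h)

  top-unique : ∀ {w w′} → w < v → v ≤ x + w → w′ < v → v ≤ x + w′ → w % x ≡ w′ % x → w ≡ w′
  top-unique {w} {w′} w<v v≤w w′<v v≤w′ hw = trans (m≡m%n+[m/n]*n w x) (trans (cong₂ (λ i j → i + j * x) hw (≤-antisym (below hw w<v v≤w′) (below (sym hw) w′<v v≤w))) (sym (m≡m%n+[m/n]*n w′ x)))
    where
    below : ∀ {w w′} → w % x ≡ w′ % x → w < v → v ≤ x + w′ → w / x ≤ w′ / x
    below {w} {w′} hw w<v v≤w′ = ≮⇒≥ λ lt → <⇒≱ w<v (≤-trans v≤w′ (≤-trans (≤-reflexive (trans (cong (x +_) (m≡m%n+[m/n]*n w′ x)) (lemma x (w′ % x) (w′ / x))))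
      (≤-trans (+-mono-≤ (≤-reflexive (sym hw)) (*-monoˡ-≤ x lt)) (≤-reflexive (sym (m≡m%n+[m/n]*n w x))))))
      where
      lemma : ∀ x j i → x + (j + i * x) ≡ j + suc i * x
      lemma = solve-∀

  tall-top : ∀ {j} → j < r → j + q * x < v × v ≤ x + (j + q * x)
  tall-top {j} j<r = ≤-trans (+-monoˡ-< (q * x) j<r) (≤-reflexive (+-comm r (q * x))) ,
    ≤-trans (≤-reflexive (+-comm (q * x) r)) (≤-trans (+-monoˡ-≤ (q * x) (≤-trans r≤x (m≤m+n x j))) (≤-reflexive (+-assoc x j (q * x))))

  short-top : ∀ {j} → r ≤ j → j < x → j + suc k * x < v × v ≤ x + (j + suc k * x)
  short-top {j} r≤j j<x = ≤-trans (+-monoˡ-< (suc k * x) j<x) (m≤m+n (q * x) r) ,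
    ≤-trans (+-monoʳ-≤ (q * x) r≤j) (≤-reflexive (lemma x j (suc k * x)))
    where
    lemma : ∀ x j i → x + i + j ≡ x + (j + i)
    lemma = solve-∀

  sound-start : Remaining lo a u → u < v × lo ≤ u % x × u % x < lo + suc a
  sound-start (remaining route _ sound _) = sound (start-∈ route)

  module _ (h : ℕ) (hr : r ≡ 3 + h * 2) where

    -- From the top of the last class still open the walk is forced down, to the left, up and to the
    -- left again, consuming two short classes. Their number is even, so finally the last long class
    -- is entered in the top row of the short ones, one below its own top, and `interior-start`
    -- applies.
    backwards : ∀ g → 5 + (h * 2 + g * 2) ≤ x → Remaining 1 (3 + (h * 2 + g * 2)) (4 + (h * 2 + g * 2) + suc k * x) → ⊥
    backwards g ≤x ρ₀ = first-turn (Run.turn R₁)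
      where
      m : ℕ
      m = h * 2 + g * 2
      R₁ : Run 1 (2 + m) (4 + m + suc k * x)
      R₁ = run-of ≤x ρ₀
      ρ₁ : Remaining 1 (2 + m) (Run.next R₁)
      ρ₁ = drop-last-residue R₁ (res (suc k) ≤x)
      r≤ : r ≤ 3 + m
      r≤ = ≤-trans (≤-reflexive hr) (s≤s (s≤s (s≤s (m≤m+n (h * 2) (g * 2)))))
      last₁ : Run.last R₁ ≡ 4 + m
      last₁ = trans (down-end R₁ (proj₂ (short-top (m≤n⇒m≤1+n r≤) ≤x))) (res (suc k) ≤x)
      next-x : ∀ {n} → n ≡ 5 + m → Remaining 1 (2 + m) n → ⊥
      next-x refl ρ with m≤n⇒m<n∨m≡n ≤x | sound-start ρ
      ... | inj₁ lt | _ , _ , p = <⇒≱ p (≤-trans (n≤1+n (4 + m)) (≤-reflexive (sym (m<n⇒m%n≡m lt))))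
      ... | inj₂ eq | _ , p , _ = 1+n≰n (subst (1 ≤_) (trans (cong (_% x) eq) (res-+0)) p)
        where
        res-+0 : x % x ≡ 0
        res-+0 = trans (cong (_% x) (sym (+-identityʳ x))) (trans (res-+ 0) (m<n⇒m%n≡m (≤-trans (s≤s z≤n) ≤x)))
      second : ∀ {n} → n ≡ 3 + m → Remaining 1 (2 + m) n → ⊥
      second refl ρ = second-turn (Run.turn R₂)
        where
        3+w<x : 3 + m < x
        3+w<x = ≤-trans (n≤1+n (4 + m)) ≤x
        R₂ : Run 1 (1 + m) (3 + m)
        R₂ = run-of (<⇒≤ ≤x) ρ
        ρ₂ : Remaining 1 (1 + m) (Run.next R₂)
        ρ₂ = drop-last-residue R₂ (m<n⇒m%n≡m 3+w<x)
        last₂ : Run.last R₂ ≡ 3 + m + suc k * x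
        last₂ with up-end R₂ 3+w<x | short-top r≤ 3+w<x
        ... | p , p′ , e | p″ , p‴ = top-unique p p′ p″ p‴ (trans e (sym (res (suc k) 3+w<x)))
        third : ∀ {n} → n ≡ 2 + m + suc k * x → Remaining 1 (1 + m) n → ⊥
        third refl ρ = by-size g refl ρ
          where
          by-size : ∀ g₀ → g₀ ≡ g → Remaining 1 (1 + m) (2 + m + suc k * x) → ⊥
          by-size zero refl ρ = interior-start′ x (subst (λ u → Route 1 x 0 u last swept 0 ℓ 0) u≡ along) uniqueV
              (completeV (≤-trans (s≤s (≤-trans (m≤n+m b₀ x) (m≤n+m (x + b₀) x))) x+x+s<v) (trans (sym (res-+ b₀)) (cong (_% x) (sym u≡))))
              (completeV x+x+s<v (trans (res-+ (x + b₀)) (cong (_% x) (sym u≡))))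
              (λ z∈ → <⇒≱ (proj₁ (soundV z∈)) (≤-trans (proj₂ (tall-top 2+w<r)) (≤-reflexive (cong (x +_) (sym top≡)))))
            where
            open Run (run-of (≤-trans (n≤1+n (3 + m)) (<⇒≤ ≤x)) ρ)
            b₀ : ℕ
            b₀ = 2 + m + k * x
            2+w<r : 2 + m < r
            2+w<r = ≤-reflexive (trans (cong (3 +_) (+-identityʳ (h * 2))) (sym hr))
            u≡ : 2 + m + suc k * x ≡ x + b₀
            u≡ = lemma (2 + m) x (k * x)
              where
              lemma : ∀ m x i → m + (x + i) ≡ x + (m + i)
              lemma = solve-∀
            top≡ : x + (x + b₀) ≡ 2 + m + q * x
            top≡ = lemma (2 + m) x (k * x)
              where
              lemma : ∀ m x i → x + (x + (m + i)) ≡ m + (x + (x + i))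
              lemma = solve-∀
            x+x+s<v : x + (x + b₀) < v
            x+x+s<v = subst (_< v) (sym top≡) (proj₁ (tall-top 2+w<r))
          by-size (suc g₀) refl ρ = backwards g₀ (≤-trans (≤-by 2 (+-comm (5 + (h * 2 + g₀ * 2)) 2)) (≤-trans (≤-reflexive (cong (5 +_) (sym m≡))) ≤x))
              (subst (λ m → Remaining 1 (1 + m) (2 + m + suc k * x)) m≡ ρ)
            where
            m≡ : m ≡ 2 + (h * 2 + g₀ * 2)
            m≡ = lemma (h * 2) (g₀ * 2)
              where
              lemma : ∀ i j → i + (2 + j) ≡ 2 + (i + j)
              lemma = solve-∀
        second-turn : Adj 1 (Run.last R₂) (Run.next R₂) → ⊥
        second-turn (inj₁ p) = third (suc-injective (trans (sym p) last₂)) ρ₂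
        second-turn (inj₂ p) with sound-start ρ₂
        ... | _ , _ , p′ = <⇒≱ p′ (≤-trans (n≤1+n (3 + m)) (≤-reflexive (sym (trans (cong (_% x) (trans p (cong suc last₂))) (res (suc k) ≤x)))))
      first-turn : Adj 1 (Run.last R₁) (Run.next R₁) → ⊥
      first-turn (inj₁ p) = second (suc-injective (trans (sym p) last₁)) ρ₁
      first-turn (inj₂ p) = next-x (trans p (cong suc last₁)) ρ₁

    -- Long classes are consumed in pairs, upwards and downwards. As `1 + l * 2` of them are left,
    -- the walk ends at the top of the last one, and the neighbouring short class has no vertex in
    -- that row. The only other choice is at class 0.
    forwards : ∀ g → 5 + (h * 2 + g * 2) ≡ x → ∀ l i j → x ≡ i + (3 + (l * 2 + j)) → r ≡ 1 + (i + l * 2) →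
      Remaining i (2 + (l * 2 + j)) i → ⊥
    forwards g x≡ l i j hx hi ρ₀ = first-turn (Run.turn R₁)
      where
      i<r : i < r
      i<r = ≤-trans (s≤s (m≤m+n i (l * 2))) (≤-reflexive (sym hi))
      i<x : i < x
      i<x = ≤-trans i<r r≤x
      R₁ : Run i (1 + (l * 2 + j)) i
      R₁ = run-of (≤-reflexive (sym hx)) ρ₀
      ρ₁ : Remaining (suc i) (1 + (l * 2 + j)) (Run.next R₁)
      ρ₁ = drop-first R₁ (m<n⇒m%n≡m i<x)
      last₁ : Run.last R₁ ≡ i + q * x
      last₁ with up-end R₁ i<x | tall-top i<r
      ... | p , p′ , e | p″ , p‴ = top-unique p p′ p″ p‴ (trans e (sym (res q i<x)))
      ahead : ∀ l {n} → r ≡ 1 + (i + l * 2) → x ≡ i + (3 + (l * 2 + j)) → n ≡ suc i + q * x → Remaining (suc i) (1 + (l * 2 + j)) n → ⊥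
      ahead zero hi hx refl ρ = <⇒≱ (proj₁ (sound-start ρ)) (≤-reflexive (trans (+-comm (q * x) r) (cong (_+ q * x) (trans hi (cong suc (+-identityʳ i))))))
      ahead (suc l) hi hx refl ρ = second-turn (Run.turn R₂)
        where
        1+i<r : suc i < r
        1+i<r = ≤-trans (≤-by (suc (l * 2)) (lemma i l)) (≤-reflexive (sym hi))
          where
          lemma : ∀ i l → suc (suc i) + suc (l * 2) ≡ 1 + (i + suc l * 2)
          lemma = solve-∀
        1+i<x : suc i < x
        1+i<x = ≤-trans 1+i<r r≤x
        R₂ : Run (suc i) (2 + (l * 2 + j)) (suc i + q * x)
        R₂ = run-of (≤-reflexive (trans (sym (+-suc i (4 + (l * 2 + j)))) (sym hx))) ρ
        ρ₂ : Remaining (2 + i) (2 + (l * 2 + j)) (Run.next R₂)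
        ρ₂ = drop-first R₂ (res q 1+i<x)
        last₂ : Run.last R₂ ≡ suc i
        last₂ = trans (down-end R₂ (proj₂ (tall-top 1+i<r))) (res q 1+i<x)
        third : ∀ {n} → n ≡ 2 + i → Remaining (2 + i) (2 + (l * 2 + j)) n → ⊥
        third refl = forwards g x≡ l (2 + i) j (trans hx (lemma i (l * 2 + j))) (trans hi (lemma′ i l))
          where
          lemma : ∀ i m → i + (3 + (2 + m)) ≡ 2 + i + (3 + m)
          lemma = solve-∀
          lemma′ : ∀ i l → 1 + (i + suc l * 2) ≡ 1 + (2 + i + l * 2)
          lemma′ = solve-∀
        second-turn : Adj 1 (Run.last R₂) (Run.next R₂) → ⊥
        second-turn (inj₂ p) = third (trans p (cong suc last₂)) ρ₂
        second-turn (inj₁ p) with sound-start ρ₂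
        ... | _ , p′ , _ = <⇒≱ p′ (≤-trans (≤-reflexive (trans (cong (_% x) (suc-injective (trans (sym p) last₂))) (m<n⇒m%n≡m i<x))) (n≤1+n i))
      behind : ∀ i′ {n} → i′ ≡ i → suc n ≡ i′ + q * x → Remaining (suc i) (1 + (l * 2 + j)) n → ⊥
      behind (suc i′) refl hn ρ with sound-start ρ
      ... | _ , p , _ = <⇒≱ p (≤-trans (≤-reflexive (trans (cong (_% x) (suc-injective hn)) (res q (<-trans (n<1+n i′) i<x)))) (n≤1+n i′))
      -- Stepping back from `q * x`, the top of class 0, leads to the top of class `x - 1`, where
      -- `backwards` takes over.
      behind zero refl hn ρ = backwards g (≤-reflexive x≡)
        (subst₂ (Remaining 1) (suc-injective (suc-injective (trans (sym hx) (sym x≡))))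
          (suc-injective (trans hn (cong (_+ suc k * x) (sym x≡)))) ρ)
      first-turn : Adj 1 (Run.last R₁) (Run.next R₁) → ⊥
      first-turn (inj₂ p) = ahead l hi hx (trans p (cong suc last₁)) ρ₁
      first-turn (inj₁ p) = behind i refl (trans (sym p) last₁) ρ₁

no-realization : ∀ h g k → let X = 5 + (h * 2 + g * 2) ; v = (2 + k) * X + (3 + h * 2) in
  ∀ {e L d} → Route 1 X 0 0 e L (4 + (h * 2 + g * 2)) d 0 → L ↭ ap 1 0 v → ⊥
no-realization h g k {L = L} route p =
  Rigid.forwards X (3 + h * 2) k r≤x h refl g refl (suc h) 0 (g * 2) refl refl
    (Rigid.remaining route (Unique-resp-↭ (↭-sym p) (Unique-ap 0 v))
      (λ {w} w∈ → proj₂ (∈-ap 0 v (∈-resp-↭ p w∈)) , z≤n , m%n<n w X)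
      (λ w<v _ _ → ∈-resp-↭ (↭-sym p) (∈-ap⁺ 0 v z≤n w<v)))
  where
  X v : ℕ
  X = 5 + (h * 2 + g * 2)
  v = (2 + k) * X + (3 + h * 2)
  r≤x : 3 + h * 2 ≤ X
  r≤x = ≤-by (2 + g * 2) (lemma h g)
    where
    lemma : ∀ h g → 3 + h * 2 + (2 + g * 2) ≡ 5 + (h * 2 + g * 2)
    lemma = solve-∀

-- Values of ω and the cases of the theorem

odd-modulus : ∀ {x} → x % 2 ≡ 1 → 1 < x → OddModulus x
odd-modulus hx 1<x with modulus 1<x
... | inj₁ odd = odd
... | inj₂ (h , refl) with trans (sym hx) (m*n%n≡0 (suc h) 2)
...   | ()

ones-needed : ∀ {x d} → 1 < x → x ≤ d → ∀ {a} → HasStdLinReal (oneZ a x d) → x ≤ suc a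
ones-needed {x} {d} 1<x x≤d {a} H with route-of-realization 1<x a d H
... | e , L , ρ , p = few-ones 1<x (≤-trans x≤d (≤-trans (m≤n+m d a) (n≤1+n (a + d)))) ρ p

omega-pred : ∀ {x y d α} → x ≡ suc α → 1 < x → x ≤ d → Std x y (suc (α + d)) α 0 → IsOmega x d α
omega-pred {d = d} {α} refl 1<x x≤d P = realize₂ α d P , λ a′ a′<α H → <⇒≱ a′<α (≤-pred (ones-needed 1<x x≤d H))

omega-odd : ∀ {x y d} k p p′ → x ≡ 2 + suc p * 2 + (p′ * 2 + 1) → d ≡ suc k * x + (3 + p * 2) → Std x y (suc (x + d)) x 0 → IsOmega x d x
omega-odd {x} {y} {d} k p p′ hx hd P = realize₂ x d P , none
  where
  x≡ : x ≡ 5 + (p * 2 + p′ * 2)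
  x≡ = trans hx (lemma p p′)
    where
    lemma : ∀ p p′ → 2 + suc p * 2 + (p′ * 2 + 1) ≡ 5 + (p * 2 + p′ * 2)
    lemma = solve-∀
  1<x : 1 < x
  1<x = subst (1 <_) (sym x≡) (s≤s (s≤s z≤n))
  x≤d : x ≤ d
  x≤d = ≤-trans (m≤m+n x (k * x)) (≤-trans (m≤m+n (suc k * x) (3 + p * 2)) (≤-reflexive (sym hd)))
  none : ∀ a′ → a′ < x → ¬ HasStdLinReal (oneZ a′ x d)
  none a′ a′<x H = go (≤-antisym a′<x (ones-needed 1<x x≤d H)) (route-of-realization 1<x a′ d H)
    where
    go : suc a′ ≡ x → (∃ λ e → ∃ λ L → Route 1 x 0 0 e L a′ d 0 × L ↭ ap 1 0 (suc (a′ + d))) → ⊥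
    go ha (e , L , ρ , q) = no-realization p p′ k
      (subst₂ (λ x a → Route 1 x 0 0 e L a d 0) x≡ (suc-injective (trans ha x≡)) ρ)
      (↭-trans q (↭-reflexive (cong (ap 1 0) (trans (cong₂ _+_ ha hd) (trans (sym (+-assoc x (suc k * x) (3 + p * 2))) (cong (λ x → (2 + k) * x + (3 + p * 2)) x≡))))))

extend-to : ∀ {x t} a₀ a b c → a₀ ≤ a → Std x (t * x) (suc (a₀ + (b + c))) a₀ c → HasStdLinReal (multL a b c x t)
extend-to {x} {t} a₀ a b c a₀≤a P with ∃-≤ a₀≤a
... | j , refl = realize {x} {t} (j + a₀) b c (std-to (lemma j a₀ b c) refl refl (std-prefixes j P))
  where
  lemma : ∀ j a₀ b c → j + suc (a₀ + (b + c)) ≡ suc (j + a₀ + b + c)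
  lemma = solve-∀

private
  quotient-≥ : ∀ {x t d} k m → m < x → t * x ≤ d → d ≡ k * x + m → t ≤ k
  quotient-≥ {x} {t} k m m<x h refl = ≮⇒≥ λ k<t → <⇒≱ (+-monoʳ-< (k * x) m<x)
    (≤-trans (≤-reflexive (+-comm (k * x) x)) (≤-trans (*-monoˡ-≤ x k<t) h))

  c-bound : ∀ {x t b c} B m → t * x ≤ b → b + c ≡ (B + t) * x + m → c ≤ B * x + m
  c-bound {x} {t} {b} {c} B m h hd = +-cancelˡ-≤ (t * x) _ _ (≤-trans (+-monoˡ-≤ c h) (≤-reflexive (trans hd (lemma B t x m))))
    where
    lemma : ∀ B t x m → (B + t) * x + m ≡ t * x + (B * x + m)
    lemma = solve-∀

module _ {x t : ℕ} (2≤t : 2 ≤ t) (1<x : 1 < x) (a b c : ℕ) (tx≤b : t * x ≤ b)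
  (size : (t + 2) * x ≤ a + b + c + 1)
  (ω≤a : ∀ w → IsOmega x (b + c) w → w ≤ a)
  (tight : ∀ q → a + b + c + 1 ≡ q * x + 1 → t * x < b) where

  private
    x≤d : x ≤ b + c
    x≤d = ≤-trans (≤-trans (≤-trans (≤-reflexive (sym (*-identityˡ x))) (*-monoˡ-≤ x (<⇒≤ 2≤t))) tx≤b) (m≤m+n b c)

    by-pred : ∀ α → x ≡ suc α → Std x (t * x) (suc (α + (b + c))) α 0 → Std x (t * x) (suc (α + (b + c))) α c → HasStdLinReal (multL a b c x t)
    by-pred α hx P₀ P = extend-to {x} {t} α a b c (ω≤a α (omega-pred hx 1<x x≤d P₀)) P

  existence : OddForm x (b + c) → HasStdLinReal (multL a b c x t)
  existence (res-0 k p hx hd) with ∃-≤ (quotient-≥ {x} {t} {b + c} k 0 (<⇒≤ 1<x) (≤-trans tx≤b (m≤m+n b c)) (trans hd (sym (+-identityʳ (k * x)))))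
  ... | B , refl = by-pred (p * 2) (trans hx (+-comm (p * 2) 1)) (std 0 z≤n) (std c c≤)
    where
    c≤ : c ≤ B * x
    c≤ = ≤-trans (c-bound {x} {t} B 0 tx≤b (trans hd (sym (+-identityʳ _)))) (≤-reflexive (+-identityʳ (B * x)))
    std : ∀ c′ → c′ ≤ B * x → Std x (t * x) (suc (p * 2 + (b + c))) (p * 2) c′
    std c′ h with low′ B p c′ (≤-trans h (≤-reflexive (trans (cong (B *_) hx) (lemma B p))))
      where
      lemma : ∀ B p → B * (p * 2 + 1) ≡ p * B * 2 + B
      lemma = solve-∀
    ... | β , γ , β≤ , γ≤ , refl = std-to (trans (lemma t B x) (trans (cong₂ _+_ (trans hx (+-comm (p * 2) 1)) (sym hd)) refl)) refl refl (std-right 2≤t B 0 p hx β γ β≤ γ≤)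
      where
      lemma : ∀ t B x → (t + suc B) * x + 0 ≡ x + (B + t) * x
      lemma = solve-∀
  existence (res-1 k zero hx hd) = ⊥-elim (<⇒≢ 1<x (sym hx))
  existence (res-1 k (suc p) hx hd) with ∃-≤ (quotient-≥ {x} {t} {b + c} k 1 1<x (≤-trans tx≤b (m≤m+n b c)) hd)
  ... | B , refl = by-c (m≤n⇒m<n∨m≡n (c-bound {x} {t} B 1 tx≤b hd))
    where
    α : ℕ
    α = suc p * 2
    std : ∀ c′ → c′ ≤ B * x → Std x (t * x) (suc (α + (b + c))) α c′
    std c′ h = std-to (trans (lemma t B x) (cong₂ _+_ hx (sym hd))) refl refl (std-1 2≤t B (suc p) hx c′ h)
      where
      lemma : ∀ t B x → suc ((t + suc B) * x) ≡ x + ((B + t) * x + 1)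
      lemma = solve-∀
    α≤a : α ≤ a
    α≤a = ω≤a α (omega-pred hx 1<x x≤d (std 0 z≤n))
    -- Here `b = t x`. If `a = x - 1`, the size would be 1 modulo `x`, where `tight` demands
    -- `t x < b`; so `a ≥ x`, as `std-bump` needs. That path requires a positive `B`; for `B = 0`,
    -- where `c = 1`, the bound `size` yields `a ≥ 2 (x - 1)`, as `std-row` needs.
    maximal : ∀ B → b + c ≡ (B + t) * x + 1 → c ≡ B * x + 1 → HasStdLinReal (multL a b c x t)
    maximal (suc B) hd hc = extend-to {x} {t} x a b c x≤a
      (std-to (trans (lemma t B x) (cong (λ d → suc (x + d)) (sym hd))) refl (sym hc) (std-bump 2≤t B p hx))
      where
      lemma : ∀ t B x → (t + (2 + B)) * x + 2 ≡ suc (x + ((suc B + t) * x + 1))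
      lemma = solve-∀
      lemma₁ : ∀ B t x → t * x + (suc B * x + 1) ≡ (suc B + t) * x + 1
      lemma₁ = solve-∀
      b≡ : b ≡ t * x
      b≡ = +-cancelʳ-≡ c b (t * x) (trans hd (trans (sym (lemma₁ B t x)) (cong (t * x +_) (sym hc))))
      x≤a : x ≤ a
      x≤a with m≤n⇒m<n∨m≡n α≤a
      ... | inj₁ α<a = ≤-trans (≤-reflexive hx) α<a
      ... | inj₂ α≡a = ⊥-elim (<⇒≢ (tight (suc (suc B + t)) (trans (lemma₂ a b c) (trans (cong₂ _+_ (trans (cong suc (sym α≡a)) (sym hx)) hd) (sym (+-assoc x _ 1))))) (sym b≡))
        where
        lemma₂ : ∀ a b c → a + b + c + 1 ≡ suc a + (b + c)
        lemma₂ = solve-∀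
    maximal zero hd hc = extend-to {x} {t} (α + α) a b c α+α≤a
      (std-to (trans (lemma t x) (trans (cong (λ i → i + (i + t * x)) hx) (trans (lemma₁ α (t * x)) (cong (λ d → suc (α + α + d)) (sym hd))))) refl (sym hc)
        (std-row 2≤t (suc p) hx))
      where
      lemma : ∀ t x → (2 + t) * x ≡ x + (x + t * x)
      lemma = solve-∀
      lemma₁ : ∀ α i → suc α + (suc α + i) ≡ suc (α + α + (i + 1))
      lemma₁ = solve-∀
      lemma₂ : ∀ a b c → a + b + c + 1 ≡ a + (b + c) + 1
      lemma₂ = solve-∀
      lemma₃ : ∀ α i → suc α + (suc α + i) ≡ α + α + (i + 2)
      lemma₃ = solve-∀
      lemma₄ : ∀ a i → a + (i + 1) + 1 ≡ a + (i + 2)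
      lemma₄ = solve-∀
      α+α≤a : α + α ≤ a
      α+α≤a = +-cancelʳ-≤ (t * x + 2) _ _ (≤-trans (≤-reflexive (sym (trans (cong (_* x) (+-comm t 2)) (trans (lemma t x) (trans (cong (λ i → i + (i + t * x)) hx) (lemma₃ α (t * x)))))))
        (≤-trans size (≤-reflexive (trans (lemma₂ a b c) (trans (cong (λ d → a + d + 1) hd) (lemma₄ a (t * x)))))))
    by-c : c < B * x + 1 ⊎ c ≡ B * x + 1 → HasStdLinReal (multL a b c x t)
    by-c (inj₁ c<) = extend-to {x} {t} α a b c α≤a (std c (≤-pred (≤-trans c< (≤-reflexive (+-comm (B * x) 1)))))
    by-c (inj₂ c≡) = maximal B hd c≡
  existence (res-even k p p′ hx hd) with ∃-≤ (quotient-≥ {x} {t} {b + c} k (2 + p * 2) (subst (2 + p * 2 <_) (sym hx) (≤-by (p′ * 2) (lemma p p′))) (≤-trans tx≤b (m≤m+n b c)) hd)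
    where
    lemma : ∀ p p′ → suc (2 + p * 2) + p′ * 2 ≡ 2 + p * 2 + (p′ * 2 + 1)
    lemma = solve-∀
  ... | B , refl = by-pred α hx₁ (std 0 z≤n) (by-c (m≤n⇒m<n∨m≡n (c-bound {x} {t} B (2 + p * 2) tx≤b hd)))
    where
    α : ℕ
    α = p * 2 + suc p′ * 2
    hx₁ : x ≡ suc α
    hx₁ = trans hx (lemma p p′)
      where
      lemma : ∀ p p′ → 2 + p * 2 + (p′ * 2 + 1) ≡ suc (p * 2 + suc p′ * 2)
      lemma = solve-∀
    std : ∀ c′ → c′ ≤ B * x + (1 + p * 2) → Std x (t * x) (suc (α + (b + c))) α c′
    std c′ h = std-to (trans (lemma t B x (p * 2)) (cong₂ _+_ hx₁ (sym hd))) refl refl (std-even 2≤t B p (suc p′) hx₁ c′ h)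
      where
      lemma : ∀ t B x i → suc ((t + suc B) * x + (1 + i)) ≡ x + ((B + t) * x + (2 + i))
      lemma = solve-∀
    by-c : c < B * x + (2 + p * 2) ⊎ c ≡ B * x + (2 + p * 2) → Std x (t * x) (suc (α + (b + c))) α c
    by-c (inj₁ c<) = std c (≤-pred (≤-trans c< (≤-reflexive (+-suc (B * x) (1 + p * 2)))))
    -- The maximal `c` is one more than a path to the left can hold, as that path spends its first
    -- step on leaving vertex 0. The path to the right attains it with every column full.
    by-c (inj₂ c≡) = std-to (trans (lemma t B x (p * 2)) (cong₂ _+_ hx₁ (sym hd))) (lemma₁ p p′)
      (trans (lemma₂ B p p′) (trans (cong (λ x → B * x + (2 + p * 2)) (sym hx₁)) (sym c≡)))
      (std-right 2≤t B (suc p) p′ hx B (suc p * suc B + p′ * B) ≤-refl ≤-refl)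
      where
      lemma : ∀ t B x i → (t + suc B) * x + (2 + i) ≡ x + ((B + t) * x + (2 + i))
      lemma = solve-∀
      lemma₁ : ∀ p p′ → suc p * 2 + p′ * 2 ≡ p * 2 + suc p′ * 2
      lemma₁ = solve-∀
      lemma₂ : ∀ B p p′ → (suc p * suc B + p′ * B) * 2 + B ≡ B * suc (p * 2 + suc p′ * 2) + (2 + p * 2)
      lemma₂ = solve-∀
  existence (res-odd k p p′ hx hd) with ∃-≤ (quotient-≥ {x} {t} {b + c} k (3 + p * 2) (subst (3 + p * 2 <_) (sym hx) (≤-by (1 + p′ * 2) (lemma p p′))) (≤-trans tx≤b (m≤m+n b c)) hd)
    where
    lemma : ∀ p p′ → suc (3 + p * 2) + (1 + p′ * 2) ≡ 2 + suc p * 2 + (p′ * 2 + 1)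
    lemma = solve-∀
  ... | B , refl = extend-to {x} {t} x a b c (ω≤a x (omega 2≤t hd (std 0 z≤n))) (std c (c-bound {x} {t} B (3 + p * 2) tx≤b hd))
    where
    hx₁ : x ≡ 3 + p * 2 + suc p′ * 2
    hx₁ = trans hx (lemma p p′)
      where
      lemma : ∀ p p′ → 2 + suc p * 2 + (p′ * 2 + 1) ≡ 3 + p * 2 + suc p′ * 2
      lemma = solve-∀
    std : ∀ c′ → c′ ≤ B * x + (3 + p * 2) → Std x (t * x) (suc (x + (b + c))) x c′
    std c′ h = std-to (cong suc (trans (lemma t B x (3 + p * 2)) (cong (x +_) (sym hd)))) refl refl (std-odd 2≤t B p p′ hx₁ c′ h)
      where
      lemma : ∀ t B x i → (t + suc B) * x + i ≡ x + ((B + t) * x + i)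
      lemma = solve-∀
    -- The case on `t` exhibits the quotient of `b + c` by `x` as a successor, so that all columns
    -- of the rigidity argument have at least two rows.
    omega : ∀ {t y} → 2 ≤ t → b + c ≡ (B + t) * x + (3 + p * 2) → Std x y (suc (x + (b + c))) x 0 → IsOmega x (b + c) x
    omega {suc t} _ hd P = omega-odd (B + t) p p′ hx (trans hd (cong (λ i → i * x + (3 + p * 2)) (+-suc B t))) P

theorem4p6 : (x t a b c q r s : ℕ) → x % 2 ≡ 1 → 1 < x → 2 ≤ t → 1 ≤ b + c →
    (t + 2) * x ≤ a + b + c + 1 →
    a + b + c + 1 ≡ q * x + r → r < x →
    s * (2 * t) ≤ q → q < suc s * (2 * t) →
    (∀ w → IsOmega x (b + c) w → w ≤ a) →
    ((r % 2 ≡ 0 × t * x ≤ b)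
    ⊎ (r % 2 ≡ 1 × t % 2 ≡ 1 × t * x + 2 * t ∸ 3 ≤ b)
    ⊎ (r % 2 ≡ 1 × t % 2 ≡ 0 × 4 * s + t * x + 4 * t ∸ 9 ≤ b)) →
    HasStdLinReal (multL a b c x t)
theorem4p6 x t a b c q r s x-odd 1<x 2≤t 1≤d size v≡ r<x s≤ <s ω≤a cases with odd-modulus x-odd 1<x
... | h , refl = existence 2≤t 1<x a b c (proj₁ b-bound) size ω≤a tight (odd-form h (b + c))
  where
  t+2≤q : t + 2 ≤ q
  t+2≤q = quotient-≥ {3 + h * 2} {t + 2} {a + b + c + 1} q r r<x size v≡
  strictly : ∀ {m n} → t * x + 1 + m ≤ n → n ∸ m ≤ b → t * x < b
  strictly {m} {n} h₁ h₂ = ≤-trans (≤-reflexive (+-comm 1 (t * x))) (≤-trans (m+n≤o⇒m≤o∸n (t * x + 1) h₁) h₂)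
  -- With `4 * s + 4 * t ≥ 10` the third bound on `b` exceeds `t * x`. The only critical pair is
  -- `t = 2`, `s = 0`; it would give `q < 4`, against `t + 2 ≤ q`.
  many : ∀ t s → 2 ≤ t → t + 2 ≤ q → q < suc s * (2 * t) → 10 ≤ 4 * s + 4 * t
  many (suc (suc (suc t))) s _ _ _ = ≤-trans (≤-by (2 + 4 * t) (lemma t)) (m≤n+m (4 * (3 + t)) (4 * s))
    where
    lemma : ∀ t → 10 + (2 + 4 * t) ≡ 4 * (3 + t)
    lemma = solve-∀
  many (suc (suc zero)) (suc s) _ _ _ = ≤-by (2 + 4 * s) (lemma s)
    where
    lemma : ∀ s → 10 + (2 + 4 * s) ≡ 4 * suc s + 8
    lemma = solve-∀
  many (suc (suc zero)) zero _ h₁ h₂ = ⊥-elim (<⇒≱ h₂ h₁)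
  many (suc zero) s (s≤s ()) _ _
  strict : t * x < b → t * x ≤ b × (r ≡ 1 → t * x < b)
  strict lt = <⇒≤ lt , λ _ → lt
  bounds : (r % 2 ≡ 0 × t * x ≤ b)
    ⊎ (r % 2 ≡ 1 × t % 2 ≡ 1 × t * x + 2 * t ∸ 3 ≤ b)
    ⊎ (r % 2 ≡ 1 × t % 2 ≡ 0 × 4 * s + t * x + 4 * t ∸ 9 ≤ b) → t * x ≤ b × (r ≡ 1 → t * x < b)
  bounds (inj₁ (r-even , h₁)) = h₁ , λ { refl → ⊥-elim (1+n≢0 r-even) }
  bounds (inj₂ (inj₁ (_ , _ , h₁))) = strict
    (strictly {3} (≤-trans (≤-reflexive (+-assoc (t * x) 1 3)) (+-monoʳ-≤ (t * x) (*-monoʳ-≤ 2 2≤t))) h₁)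
  bounds (inj₂ (inj₂ (_ , _ , h₁))) = strict
    (strictly {9} (≤-trans (≤-reflexive (+-assoc (t * x) 1 9)) (≤-trans (+-monoʳ-≤ (t * x) (many t s 2≤t t+2≤q <s)) (≤-reflexive (lemma s t (t * x))))) h₁)
    where
    lemma : ∀ s t i → i + (4 * s + 4 * t) ≡ 4 * s + i + 4 * t
    lemma = solve-∀
  b-bound : t * x ≤ b × (r ≡ 1 → t * x < b)
  b-bound = bounds cases
  tight : ∀ q′ → a + b + c + 1 ≡ q′ * x + 1 → t * x < b
  tight q′ eq = proj₂ b-bound (trans (sym (remainder q r r<x v≡)) (remainder q′ 1 1<x eq))
    where
    remainder : ∀ q r → r < x → a + b + c + 1 ≡ q * x + r → (a + b + c + 1) % x ≡ r
    remainder q r r<x eq = trans (cong (_% x) (trans eq (+-comm (q * x) r))) (trans ([m+kn]%n≡m%n r q x) (m<n⇒m%n≡m r<x))
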